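{- Let $G$ be a finite simple graph and let $\overline{G}$ denote its complement. The following three properties are equivalent: (i) $G$ is (wheel, antiwheel)-free, i.e., no induced subgraph of $G$ is isomorphic to a wheel or to an antiwheel; (ii) $G$ has no induced subgraph on at most seven vertices that is isomorphic to a wheel or to an antiwheel; (iii) $G$ or $\overline{G}$ is either a $5$-hole (i.e., isomorphic to the cycle $C_5$), a $6$-hole (i.e., isomorphic to $C_6$), a split graph, or a member of $\mathcal{A}\cup\mathcal{B}\cup\mathcal{C}$.
   Context: All graphs are finite and simple. A hole is a chordless (induced) cycle of length at least $4$; a $k$-hole is a hole on $k$ vertices. A wheel is a graph consisting of a chordless cycle of length at least $4$ together with one additional vertex that has at least three neighbors on the cycle. An antiwheel is the complement of a wheel. A graph is $\mathcal{F}$-free if it has no induced subgraph isomorphic to a member of $\mathcal{F}$. A set $S$ is complete (resp. anticomplete) to a set $T$ if every vertex of $S$ is adjacent (resp. non-adjacent) to every vertex of $T$. A graph is split if its vertex set can be partitioned into a stable set and a clique. $P_5$ denotes the path on $5$ vertices. Class $\mathcal{A}$: $G\in\mathcal{A}$ if $V(G)$ can be partitioned into two sets $\{a,b,c,d,e\}$ (five distinct vertices) and $X$ such that: $\{a,b,c,d\}$ induces a hole with edges $ab,bc,cd,da$; $X$ is non-empty, is a clique, is complete to $\{c,d\}$ and anticomplete to $\{a,b\}$; $e$ is complete to $X$, anticomplete to $\{a,b\}$, and has at most one neighbor in $\{c,d\}$. Class $\mathcal{B}$: $G\in\mathcal{B}$ if $V(G)$ can be partitioned into four stable sets $X,Y,Z,W$,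 with two special vertices $x\in X$ and $y\in Y$, such that: $|X|\ge 2$, $|Y|\ge 2$, and $X\cup Y$ induces a connected $P_5$-free bipartite graph; $W$ is anticomplete to $X\cup Y\cup Z$; $x$ is complete to $Y$ and $y$ is complete to $X$; $Z$ is complete to $\{x,y\}$ and anticomplete to $(X\cup Y)\setminus\{x,y\}$. Class $\mathcal{C}$: $G\in\mathcal{C}$ if $V(G)$ can be partitioned into two cliques $X$ and $Y$, each of size at least $2$, such that the set of edges between $X$ and $Y$ forms a matching of size exactly $2$. -}

module Defs where

open import Data.Nat using (ℕ; zero; suc; _≤_; _≡ᵇ_)
open import Data.Fin using (Fin; zero; suc; toℕ; _≟_)
open import Data.Fin.Subset using (Subset; ∣_∣)
open import Data.Vec using (lookup)
open import Data.Bool using (Bool; true; false; not; _∧_; _∨_; if_then_else_)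
open import Data.Product using (Σ; _×_; _,_; ∃)
open import Data.Sum using (_⊎_)
open import Data.Empty using (⊥-elim)
open import Relation.Nullary using (¬_; does; yes; no)
open import Relation.Binary.PropositionalEquality using (_≡_; _≢_; refl; sym; cong)
open import Function.Definitions using (Injective)

record Graph (n : ℕ) : Set where
  field
    adj     : Fin n → Fin n → Bool
    adj-sym : ∀ i j → adj i j ≡ adj j i
    adj-irr : ∀ i → adj i i ≡ false
open Graph public

complement : ∀ {n} → Graph n → Graph n
complement {n} G = record { adj = a ; adj-sym = s ; adj-irr = r }
  where
  a : Fin n → Fin n → Bool
  a i j = if does (i ≟ j) then false else not (adj G i j)
  s : ∀ i j → a i j ≡ a j i
  s i j with i ≟ j | j ≟ i
  ... | yes _ | yes _ = refl
  ... | yes p | no q = ⊥-elim (q (sym p))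
  ... | no p | yes q = ⊥-elim (p (sym q))
  ... | no _ | no _ = cong not (adj-sym G i j)
  r : ∀ i → a i i ≡ false
  r i with i ≟ i
  ... | yes _ = refl
  ... | no p = ⊥-elim (p refl)

-- Induced subgraphs: H (an adjacency pattern on Fin m, only its
-- off-diagonal entries matter) is isomorphic to an induced subgraph of G
-- iff there is an injective map preserving adjacency and non-adjacency.

InducedIn : ∀ {m n} → (Fin m → Fin m → Bool) → Graph n → Set
InducedIn {m} {n} H G =
  Σ (Fin m → Fin n) λ f →
    Injective _≡_ _≡_ f × (∀ i j → i ≢ j → H i j ≡ adj G (f i) (f j))

InducedInside : ∀ {m n} → (Fin m → Fin m → Bool) → Graph n → (Fin n → Set) → Set
InducedInside {m} {n} H G P =
  Σ (Fin m → Fin n) λ f →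
    Injective _≡_ _≡_ f × (∀ i → P (f i)) ×
    (∀ i j → i ≢ j → H i j ≡ adj G (f i) (f j))

IsoTo : ∀ {m n} → (Fin m → Fin m → Bool) → Graph n → Set
IsoTo {m} {n} H G =
  Σ (Fin m → Fin n) λ f →
    Injective _≡_ _≡_ f × (∀ v → ∃ λ i → f i ≡ v) ×
    (∀ i j → i ≢ j → H i j ≡ adj G (f i) (f j))

cycleAdj : (k : ℕ) → Fin k → Fin k → Bool
cycleAdj k i j =
  (suc (toℕ i) ≡ᵇ toℕ j) ∨ (suc (toℕ j) ≡ᵇ toℕ i) ∨
  ((toℕ i ≡ᵇ 0) ∧ (suc (toℕ j) ≡ᵇ k)) ∨ ((toℕ j ≡ᵇ 0) ∧ (suc (toℕ i) ≡ᵇ k))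

P5Adj : Fin 5 → Fin 5 → Bool
P5Adj i j = (suc (toℕ i) ≡ᵇ toℕ j) ∨ (suc (toℕ j) ≡ᵇ toℕ i)

-- The wheel with rim C_k (vertices suc i) and hub zero adjacent
-- exactly to the rim vertices in S.  (A wheel in the sense of the paper
-- is any graph isomorphic to wheelAdj k S with k ≥ 4 and ∣ S ∣ ≥ 3.)
wheelAdj : (k : ℕ) → Subset k → Fin (suc k) → Fin (suc k) → Bool
wheelAdj k S zero zero = false
wheelAdj k S zero (suc j) = lookup S j
wheelAdj k S (suc i) zero = lookup S i
wheelAdj k S (suc i) (suc j) = cycleAdj k i j

antiwheelAdj : (k : ℕ) → Subset k → Fin (suc k) → Fin (suc k) → Bool
antiwheelAdj k S i j = not (wheelAdj k S i j)

HasWheelOfSize≤ : ∀ {n} → ℕ → Graph n → Set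
HasWheelOfSize≤ bound G =
  Σ ℕ λ k → 4 ≤ k × suc k ≤ bound ×
    Σ (Subset k) λ S → 3 ≤ ∣ S ∣ × InducedIn (wheelAdj k S) G

HasAntiwheelOfSize≤ : ∀ {n} → ℕ → Graph n → Set
HasAntiwheelOfSize≤ bound G =
  Σ ℕ λ k → 4 ≤ k × suc k ≤ bound ×
    Σ (Subset k) λ S → 3 ≤ ∣ S ∣ × InducedIn (antiwheelAdj k S) G

HasWheel : ∀ {n} → Graph n → Set
HasWheel G =
  Σ ℕ λ k → 4 ≤ k × Σ (Subset k) λ S → 3 ≤ ∣ S ∣ × InducedIn (wheelAdj k S) G

HasAntiwheel : ∀ {n} → Graph n → Set
HasAntiwheel G =
  Σ ℕ λ k → 4 ≤ k × Σ (Subset k) λ S → 3 ≤ ∣ S ∣ × InducedIn (antiwheelAdj k S) G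

WheelAntiwheelFree : ∀ {n} → Graph n → Set
WheelAntiwheelFree G = ¬ HasWheel G × ¬ HasAntiwheel G

NoSmallWheelAntiwheel : ∀ {n} → Graph n → Set
NoSmallWheelAntiwheel G = ¬ HasWheelOfSize≤ 7 G × ¬ HasAntiwheelOfSize≤ 7 G

IsHole : ∀ {n} → ℕ → Graph n → Set
IsHole k G = IsoTo (cycleAdj k) G

IsSplit : ∀ {n} → Graph n → Set
IsSplit {n} G = Σ (Fin n → Bool) λ side →
  (∀ u v → u ≢ v → side u ≡ true → side v ≡ true → adj G u v ≡ true) ×
  (∀ u v → side u ≡ false → side v ≡ false → adj G u v ≡ false)

InA : ∀ {n} → Graph n → Set
InA {n} G = Σ (Fin n) λ a → Σ (Fin n) λ b → Σ (Fin n) λ c → Σ (Fin n) λ d → Σ (Fin n) λ e →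
  (a ≢ b × a ≢ c × a ≢ d × a ≢ e × b ≢ c × b ≢ d × b ≢ e × c ≢ d × c ≢ e × d ≢ e) ×
  (adj G a b ≡ true × adj G b c ≡ true × adj G c d ≡ true × adj G d a ≡ true ×
   adj G a c ≡ false × adj G b d ≡ false) ×
  (Σ (Fin n) λ x → InX a b c d e x) ×
  (∀ x y → InX a b c d e x → InX a b c d e y → x ≢ y → adj G x y ≡ true) ×
  (∀ x → InX a b c d e x →
     adj G x c ≡ true × adj G x d ≡ true × adj G x a ≡ false × adj G x b ≡ false) ×
  (∀ x → InX a b c d e x → adj G e x ≡ true) ×
  (adj G e a ≡ false × adj G e b ≡ false × (adj G e c ∧ adj G e d) ≡ false)
  where
  InX : Fin n → Fin n → Fin n → Fin n → Fin n → Fin n → Set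
  InX a b c d e v = v ≢ a × v ≢ b × v ≢ c × v ≢ d × v ≢ e

data Reach {n} (G : Graph n) (P : Fin n → Set) : Fin n → Fin n → Set where
  here : ∀ {u} → Reach G P u u
  step : ∀ {u v w} → adj G u v ≡ true → P v → Reach G P v w → Reach G P u w

ConnectedOn : ∀ {n} → Graph n → (Fin n → Set) → Set
ConnectedOn {n} G P = ∀ u v → P u → P v → Reach G P u v

data Part : Set where
  pX pY pZ pW : Part

InB : ∀ {n} → Graph n → Set
InB {n} G = Σ (Fin n → Part) λ L → Σ (Fin n) λ x → Σ (Fin n) λ y →
  L x ≡ pX × L y ≡ pY ×
  (∀ u v → L u ≡ L v → adj G u v ≡ false) ×
  (Σ (Fin n) λ x' → L x' ≡ pX × x' ≢ x) ×
  (Σ (Fin n) λ y' → L y' ≡ pY × y' ≢ y) ×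
  ConnectedOn G (XY L) ×
  ¬ InducedInside P5Adj G (XY L) ×
  (∀ w u → L w ≡ pW → L u ≢ pW → adj G w u ≡ false) ×
  (∀ v → L v ≡ pY → adj G x v ≡ true) ×
  (∀ v → L v ≡ pX → adj G y v ≡ true) ×
  (∀ z → L z ≡ pZ → adj G z x ≡ true × adj G z y ≡ true) ×
  (∀ z v → L z ≡ pZ → XY L v → v ≢ x → v ≢ y → adj G z v ≡ false)
  where
  XY : (Fin n → Part) → Fin n → Set
  XY L v = L v ≡ pX ⊎ L v ≡ pY

InC : ∀ {n} → Graph n → Set
InC {n} G = Σ (Fin n → Bool) λ side →
  (∀ u v → u ≢ v → side u ≡ side v → adj G u v ≡ true) ×
  (Σ (Fin n) λ u → Σ (Fin n) λ v → u ≢ v × side u ≡ true × side v ≡ true) ×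
  (Σ (Fin n) λ u → Σ (Fin n) λ v → u ≢ v × side u ≡ false × side v ≡ false) ×
  (Σ (Fin n) λ x₁ → Σ (Fin n) λ x₂ → Σ (Fin n) λ y₁ → Σ (Fin n) λ y₂ →
    side x₁ ≡ true × side x₂ ≡ true × side y₁ ≡ false × side y₂ ≡ false ×
    x₁ ≢ x₂ × y₁ ≢ y₂ ×
    adj G x₁ y₁ ≡ true × adj G x₂ y₂ ≡ true ×
    (∀ u v → side u ≡ true → side v ≡ false → adj G u v ≡ true →
       (u ≡ x₁ × v ≡ y₁) ⊎ (u ≡ x₂ × v ≡ y₂)))

Basic : ∀ {n} → Graph n → Set
Basic G = IsHole 5 G ⊎ IsHole 6 G ⊎ IsSplit G ⊎ InA G ⊎ InB G ⊎ InC G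

Structured : ∀ {n} → Graph n → Set
Structured G = Basic G ⊎ Basic (complement G)

{-# OPTIONS --safe #-}
-- Every wheel with a rim of at least seven vertices contains the antiwheel P₃ + K₂, so (i) and (ii) agree.
-- For (ii) ⇒ (iii): a vertex added to C₅ or C₆ creates a wheel or antiwheel, so let G have no C₅, C₆ and
-- complement of C₆.  If G has neither C₄ nor 2K₂, it is split.  Otherwise look at a C₄ of G (or of its
-- complement).  Six-vertex seeds of 𝒜 and 𝒞 are rigid: every further vertex, and every pair of them, is forced
-- into the class.  Without seeds, a house (C₄ with a vertex on one edge) forces ℬ with that edge as xy; without
-- houses, G is triangle-free and 2K₂-free, hence a chain graph with isolated vertices, and x, y are vertices
-- with maximal neighbourhoods.
--
-- The forcing is computed: a configuration of vertices is a matrix of relations, and the possible rows of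
-- further vertices are those that create no forbidden pattern.
module Submission where

open import Defs
open import Data.Nat using (ℕ; zero; suc; _+_; _≤_; _<_; _≤ᵇ_; _≤?_; z≤n; s≤s)
import Data.Nat.Properties as ℕₚ
open import Data.Fin using (Fin; zero; suc; _≟_; _↑ˡ_)
open import Data.Fin.Patterns
open import Data.Fin.Properties using (any?; all?; suc-injective; ¬∀⟶∃¬; injective⇒≤)
open import Data.Fin.Subset using (Subset; ∣_∣) renaming (_∈_ to _∈ₛ_)
open import Data.Fin.Subset.Properties using (∣p∣≤n; p⊂q⇒∣p∣<∣q∣)
open import Data.Bool using (Bool; true; false; not; _∧_; _∨_; _xor_; if_then_else_)
open import Data.Bool.Properties using (T?; T-≡; not-involutive; not-¬; ¬-not; ∧-zeroʳ; ∨-zeroʳ; xor-same) renaming (_≟_ to _≟ᵇ_)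
open import Data.Bool.ListAction using (any; all)
open import Data.Product using (Σ; _×_; _,_; ∃; proj₁; proj₂)
open import Data.Sum using (_⊎_; inj₁; inj₂)
open import Data.Unit using (⊤; tt)
open import Data.Empty using (⊥; ⊥-elim)
open import Data.List using (List; []; _∷_; map; _++_; filterᵇ; allFin; cartesianProductWith; null)
open import Data.List.Membership.Propositional using (_∈_)
open import Data.List.Membership.Propositional.Properties using (∈-map⁺; ∈-++⁺ˡ; ∈-++⁺ʳ; ∈-filter⁺; ∈-allFin; ∈-cartesianProductWith⁺)
open import Data.List.Relation.Unary.Any using (here; there)
open import Data.List.Relation.Unary.All using (All; []; _∷_)
import Data.List.Relation.Unary.All as All
open import Data.Vec using (Vec; []; _∷_; lookup; tabulate) renaming (map to mapᵛ; _++_ to _++ᵛ_)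
open import Data.Vec.Properties using (lookup∘tabulate; tabulate-cong; lookup-map; lookup⇒[]=; []=⇒lookup)
open import Function using (_∘_; id; case_of_)
open import Function.Bundles using (_⇔_; mk⇔; Equivalence)
open import Relation.Nullary using (¬_; Dec; does; yes; no)
open import Relation.Nullary.Decidable using (map′; _→-dec_; _×-dec_; ¬?; dec-true; dec-false)
open import Relation.Binary.PropositionalEquality using (_≡_; _≢_; refl; sym; trans; cong; cong₂; subst; subst₂)

-- The classes have members of every size, while the forcing can be computed only on boundedly many
-- vertices. Once a seed is fixed, membership in 𝒜 or 𝒞 is a condition on pairs of vertices, so it
-- suffices to add two vertices to the seed. In ℬ the conditions beyond pairs are connectedness,
-- which holds through x and y, and P₅-freeness, which is traded for the absence of a 2K₂ among the
-- vertices of X and Y other than x and y. In the other direction each class is described by a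
-- finite table of labels, and a small wheel or antiwheel in any member would give a labelling of at
-- most seven vertices.
--
-- The order of the searches matters. Each seed contains a house, and a member of 𝒜 with two
-- vertices in X contains a seed of 𝒞, so 𝒜 is settled before 𝒞, and both before houses are
-- considered. The triangle-free case has no seed: its neighbourhoods form chains of arbitrary
-- length, and x and y need not lie on the C₄ at hand. This is why it is argued by hand through
-- nested neighbourhoods.

variable
  k m n : ℕ
  A : Set

-- Booleans and lists of Booleans

∧-split : ∀ {a b} → a ∧ b ≡ true → a ≡ true × b ≡ true
∧-split {true} {true} _ = refl , refl

∧-join : ∀ {a b} → a ≡ true → b ≡ true → a ∧ b ≡ true
∧-join refl refl = refl

∨-resolve : ∀ {a b} → a ∨ b ≡ true → b ≡ false → a ≡ true
∨-resolve {true} _ _ = refl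
∨-resolve {false} {false} () _

off : ∀ {b} → not b ≡ true → b ≡ false
off {false} _ = refl

all-∈ : ∀ (p : A → Bool) {xs x} → all p xs ≡ true → x ∈ xs → p x ≡ true
all-∈ p {y ∷ xs} h (here refl) = proj₁ (∧-split h)
all-∈ p {y ∷ xs} h (there i)   = all-∈ p (proj₂ (∧-split {p y} h)) i

any-∈ : ∀ (p : A → Bool) xs → any p xs ≡ true → ∃ λ x → x ∈ xs × p x ≡ true
any-∈ p (y ∷ xs) h with p y in eq
... | true  = y , here refl , eq
... | false with x , i , e ← any-∈ p xs h = x , there i , e

∈-filterᵇ : ∀ (p : A → Bool) {xs x} → x ∈ xs → p x ≡ true → x ∈ filterᵇ p xs
∈-filterᵇ p i e = ∈-filter⁺ (T? ∘ p) i (Equivalence.from T-≡ e)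

∈-null : ∀ {xs : List A} {x} → null xs ≡ true → ¬ x ∈ xs
∈-null {xs = _ ∷ _} ()

vectors : List A → ∀ m → List (Vec A m)
vectors xs zero    = [] ∷ []
vectors xs (suc m) = cartesianProductWith _∷_ xs (vectors xs m)

∈-vectors : ∀ {xs : List A} (v : Vec A m) → (∀ i → lookup v i ∈ xs) → v ∈ vectors xs m
∈-vectors []      h = here refl
∈-vectors (x ∷ v) h = ∈-cartesianProductWith⁺ _∷_ (h zero) (∈-vectors v (h ∘ suc))

bools : List Bool
bools = true ∷ false ∷ []

∈-bools : ∀ b → b ∈ bools
∈-bools true  = here refl
∈-bools false = there (here refl)

-- Backtracking search

Constraint : ℕ → ℕ → Set
Constraint k m = Fin k → Fin k → Fin m → Fin m → Bool

Solution : Constraint k m → (Fin k → Fin m → Bool) → Set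
Solution {k} {m} C D = Σ (Fin k → Fin m) λ f →
  (∀ i → D i (f i) ≡ true) × (∀ i j → i ≢ j → C i j (f i) (f j) ≡ true)

residual : Constraint (suc k) m → (Fin (suc k) → Fin m → Bool) → Fin m → Fin k → Fin m → Bool
residual C D w i v = D (suc i) v ∧ (C zero (suc i) w v ∧ C (suc i) zero v w)

-- Forward checking: a choice for the first variable shrinks the domains `D` of the others, so dead
-- branches are cut before they are entered. Constraints are tested in both orders, because a
-- template may be asymmetric. `attempt` matches on the domain test so that evaluation never opens
-- the subproblem of an excluded value.
solve : (C : Constraint k m) (D : Fin k → Fin m → Bool) → Dec (Solution C D)
solve {zero} C D = yes ((λ ()) , (λ ()) , λ ())
solve {suc k} {m} C D = map′ glue split (any? λ w → attempt w (D zero w ≟ᵇ true))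
  where
  C′ : Constraint k m
  C′ i j = C (suc i) (suc j)
  Rest : Fin m → Set
  Rest w = D zero w ≡ true × Solution C′ (residual C D w)
  attempt : ∀ w → Dec (D zero w ≡ true) → Dec (Rest w)
  attempt w (no ¬p) = no (¬p ∘ proj₁)
  attempt w (yes p) = map′ (p ,_) proj₂ (solve C′ (residual C D w))
  glue : ∃ Rest → Solution C D
  glue (w , p , f , u , b) = g , u′ , b′
    where
    g : Fin (suc k) → Fin m
    g zero    = w
    g (suc i) = f i
    u′ : ∀ i → D i (g i) ≡ true
    u′ zero    = p
    u′ (suc i) = proj₁ (∧-split (u i))
    new : ∀ i → C zero (suc i) w (f i) ≡ true × C (suc i) zero (f i) w ≡ true
    new i = ∧-split (proj₂ (∧-split {D (suc i) (f i)} (u i)))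
    b′ : ∀ i j → i ≢ j → C i j (g i) (g j) ≡ true
    b′ zero    zero    i≢j = ⊥-elim (i≢j refl)
    b′ zero    (suc j) _   = proj₁ (new j)
    b′ (suc i) zero    _   = proj₂ (new i)
    b′ (suc i) (suc j) i≢j = b i j (i≢j ∘ cong suc)
  split : Solution C D → ∃ Rest
  split (f , u , b) = f zero , u zero , f ∘ suc ,
    (λ i → ∧-join (u (suc i)) (∧-join (b zero (suc i) (λ ())) (b (suc i) zero (λ ())))) ,
    λ i j i≢j → b (suc i) (suc j) (i≢j ∘ suc-injective)

-- The relation of two vertices, including equality

data Rel : Set where
  same edge none : Rel

⟦_⟧ : Bool → Rel
⟦ true  ⟧ = edge
⟦ false ⟧ = none

_==_ : Rel → Rel → Bool
same == same = true
edge == edge = true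
none == none = true
_    == _    = false

==⇒≡ : ∀ {r s} → (r == s) ≡ true → r ≡ s
==⇒≡ {same} {same} _ = refl
==⇒≡ {edge} {edge} _ = refl
==⇒≡ {none} {none} _ = refl

==-refl : ∀ r → (r == r) ≡ true
==-refl same = refl
==-refl edge = refl
==-refl none = refl

dispersed : ∀ {r} → r ≢ edge → r ≢ same → r ≡ none
dispersed {same} _ ≢s = ⊥-elim (≢s refl)
dispersed {edge} ≢e _ = ⊥-elim (≢e refl)
dispersed {none} _ _  = refl

⟦⟧-injective : ∀ {a b} → ⟦ a ⟧ ≡ ⟦ b ⟧ → a ≡ b
⟦⟧-injective {true}  {true}  _ = refl
⟦⟧-injective {false} {false} _ = refl

⟦⟧≢same : ∀ {b} → ⟦ b ⟧ ≢ same
⟦⟧≢same {true} ()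
⟦⟧≢same {false} ()

rel : Graph n → Fin n → Fin n → Rel
rel G u v = if does (u ≟ v) then same else ⟦ adj G u v ⟧

module _ (G : Graph n) where

  rel-refl : ∀ u → rel G u u ≡ same
  rel-refl u rewrite dec-true (u ≟ u) refl = refl

  rel-≢ : ∀ {u v} → u ≢ v → rel G u v ≡ ⟦ adj G u v ⟧
  rel-≢ {u} {v} u≢v rewrite dec-false (u ≟ v) u≢v = refl

  rel-same : ∀ {u v} → rel G u v ≡ same → u ≡ v
  rel-same {u} {v} e with u ≟ v
  ... | yes u≡v = u≡v
  ... | no  _   = ⊥-elim (⟦⟧≢same e)

  rel-⟦⟧ : ∀ {u v b} → rel G u v ≡ ⟦ b ⟧ → u ≢ v × adj G u v ≡ b
  rel-⟦⟧ {u} {v} e with u ≟ v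
  ... | yes _   = ⊥-elim (⟦⟧≢same (sym e))
  ... | no  u≢v = u≢v , ⟦⟧-injective e

  rel-sym : ∀ u v → rel G u v ≡ rel G v u
  rel-sym u v with u ≟ v | v ≟ u
  ... | yes _ | yes _ = refl
  ... | yes p | no q  = ⊥-elim (q (sym p))
  ... | no p  | yes q = ⊥-elim (p (sym q))
  ... | no _  | no _  = cong ⟦_⟧ (adj-sym G u v)

  adj⇒≢ : ∀ {u v} → adj G u v ≡ true → u ≢ v
  adj⇒≢ {u} e refl with () ← trans (sym e) (adj-irr G u)

  rel-edge : ∀ {u v} → adj G u v ≡ true → rel G u v ≡ edge
  rel-edge e = trans (rel-≢ (adj⇒≢ e)) (cong ⟦_⟧ e)

  rel-none : ∀ {u v} → u ≢ v → adj G u v ≡ false → rel G u v ≡ none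
  rel-none u≢v e = trans (rel-≢ u≢v) (cong ⟦_⟧ e)

-- Patterns and matrices

Adjacency : ℕ → Set
Adjacency k = Fin k → Fin k → Bool

Pattern : Set
Pattern = Σ ℕ Adjacency

co : Adjacency k → Adjacency k
co P i j = not (P i j)

Mat : ℕ → Set
Mat m = Fin m → Fin m → Rel

_▹_ : Mat m → Vec Rel m → Mat (suc m)
(M ▹ r) zero    zero    = same
(M ▹ r) zero    (suc j) = lookup r j
(M ▹ r) (suc i) zero    = lookup r i
(M ▹ r) (suc i) (suc j) = M i j

-- The diagonal is overwritten because patterns such as `co P` carry meaningless values there.
matrix : Adjacency k → Mat k
matrix P i j = if does (i ≟ j) then same else ⟦ P i j ⟧

-- Injectivity comes for free: `⟦_⟧` never takes the value `same`, so two indices of the pattern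
-- cannot share a vertex.
occursIn : Mat m → Pattern → Bool
occursIn M (k , P) = does (solve {k} (λ i j u v → M u v == ⟦ P i j ⟧) (λ _ _ → true))

record Realises (G : Graph n) (M : Mat m) (f : Fin m → Fin n) : Set where
  constructor realises
  field relations : ∀ i j → rel G (f i) (f j) ≡ M i j
open Realises

_◃_ : A → (Fin m → A) → Fin (suc m) → A
(v ◃ f) zero    = v
(v ◃ f) (suc i) = f i

does-true : {P : Set} (d : Dec P) → does d ≡ true → P
does-true (yes p) _ = p

FreeOf : List Pattern → Graph n → Set
FreeOf ps G = All (λ p → ¬ InducedIn (proj₂ p) G) ps

module _ {G : Graph n} where

  induced : {P : Adjacency k} (f : Fin k → Fin n) →
    (∀ i j → i ≢ j → rel G (f i) (f j) ≡ ⟦ P i j ⟧) → InducedIn P G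
  induced f h = f , inj , λ i j i≢j → sym (proj₂ (rel-⟦⟧ G (h i j i≢j)))
    where
    inj : ∀ {i j} → f i ≡ f j → i ≡ j
    inj {i} {j} e with i ≟ j
    ... | yes i≡j = i≡j
    ... | no  i≢j = ⊥-elim (proj₁ (rel-⟦⟧ G (h i j i≢j)) e)

  induced-rel : {P : Adjacency k} ((f , _) : InducedIn P G) →
    ∀ i j → i ≢ j → rel G (f i) (f j) ≡ ⟦ P i j ⟧
  induced-rel (f , inj , h) i j i≢j = trans (rel-≢ G (i≢j ∘ inj)) (cong ⟦_⟧ (sym (h i j i≢j)))

  induced-realises : {P : Adjacency k} (h : InducedIn P G) → Realises G (matrix P) (proj₁ h)
  induced-realises {P = P} h = realises r
    where
    r : ∀ i j → rel G (proj₁ h i) (proj₁ h j) ≡ matrix P i j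
    r i j with i ≟ j
    ... | yes refl = rel-refl G _
    ... | no  i≢j  = induced-rel h i j i≢j

  induced? : (P : Adjacency k) → Dec (InducedIn P G)
  induced? P = map′
    (λ (f , _ , h) → induced f λ i j i≢j → ==⇒≡ (h i j i≢j))
    (λ h → proj₁ h , (λ _ → refl) , λ i j i≢j →
      subst (λ r → (r == ⟦ P i j ⟧) ≡ true) (sym (induced-rel h i j i≢j)) (==-refl ⟦ P i j ⟧))
    (solve (λ i j u v → rel G u v == ⟦ P i j ⟧) (λ _ _ → true))

  occurs-inside : {M : Mat m} {f : Fin m → Fin n} {P : Adjacency k} (In : Fin n → Set) → (∀ i → In (f i)) →
    Realises G M f → occursIn M (k , P) ≡ true → InducedInside P G In
  occurs-inside {M = M} {f} {P} In inside R e
    with g , _ , h ← does-true (solve (λ i j u v → M u v == ⟦ P i j ⟧) (λ _ _ → true)) e =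
    let (_ , inj , h′) = induced {P = P} (f ∘ g) λ i j i≢j → trans (relations R _ _) (==⇒≡ (h i j i≢j))
    in f ∘ g , inj , inside ∘ g , h′

  occurs : {M : Mat m} {f : Fin m → Fin n} {P : Adjacency k} →
    Realises G M f → occursIn M (k , P) ≡ true → InducedIn P G
  occurs R e with f , inj , _ , h ← occurs-inside (λ _ → ⊤) (λ _ → tt) R e = f , inj , h

  subpattern : {P : Adjacency k} (Q : Adjacency m) →
    occursIn (matrix Q) (k , P) ≡ true → InducedIn Q G → InducedIn P G
  subpattern Q e h = occurs (induced-realises h) e

  add : {M : Mat m} {f : Fin m → Fin n} (v : Fin n) (r : Vec Rel m) →
    (∀ i → rel G v (f i) ≡ lookup r i) → Realises G M f → Realises G (M ▹ r) (v ◃ f)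
  add {M = M} {f} v r h R = realises s
    where
    s : ∀ i j → rel G ((v ◃ f) i) ((v ◃ f) j) ≡ (M ▹ r) i j
    s zero    zero    = rel-refl G _
    s zero    (suc j) = h j
    s (suc i) zero    = trans (rel-sym G _ _) (h i)
    s (suc i) (suc j) = relations R i j

  clash : ∀ ps {M : Mat m} {f : Fin m → Fin n} → FreeOf ps G → Realises G M f →
    any (occursIn M) ps ≡ true → ⊥
  clash ps free R e with p , i , o ← any-∈ _ ps e = All.lookup free i (occurs R o)

empty : {G : Graph n} → Realises {m = 0} G (λ ()) (λ ())
empty = realises λ ()

-- Rows: the possible relations of a further vertex to a configuration

row : Graph n → (Fin m → Fin n) → Fin n → Vec Rel m
row G f v = tabulate λ i → rel G v (f i)

edge-none : List Rel
edge-none = edge ∷ none ∷ []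

-- The first summand lets the further vertex coincide with one of the configuration. One check thus
-- covers every overlap, and the relations to the seed itself are treated like all others.
rows : Mat m → List (Vec Rel m)
rows {m} M = map (λ i → tabulate (M i)) (allFin m) ++ vectors edge-none m

⟦⟧∈ : ∀ b → ⟦ b ⟧ ∈ edge-none
⟦⟧∈ true  = here refl
⟦⟧∈ false = there (here refl)

-- Equal vertices must have the same relations to the others; the vertex zero is new.
coherent : Mat (suc m) → Bool
coherent {m} N = all (λ i → all (test i) (allFin m)) (allFin m)
  where
  test : Fin m → Fin m → Bool
  test i j = (not (N zero (suc i) == same) ∨ (N zero (suc j) == N (suc i) (suc j)))
           ∧ (not (N (suc i) (suc j) == same) ∨ (N zero (suc i) == N zero (suc j)))

admissible : List Pattern → Mat (suc m) → Bool
admissible ps N = coherent N ∧ not (any (occursIn N) ps)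

module _ {G : Graph n} where

  row-outside : {f : Fin m → Fin n} {v : Fin n} → (∀ i → v ≢ f i) →
    row G f v ∈ vectors edge-none m
  row-outside {f = f} {v} h = ∈-vectors _ λ i →
    subst (_∈ edge-none) (sym (trans (lookup∘tabulate _ i) (rel-≢ G (h i)))) (⟦⟧∈ _)

  row-inside : {M : Mat m} {f : Fin m → Fin n} → Realises G M f → ∀ i → row G f (f i) ≡ tabulate (M i)
  row-inside R i = tabulate-cong (relations R i)

  row∈rows : {M : Mat m} {f : Fin m → Fin n} → Realises G M f → ∀ v → row G f v ∈ rows M
  row∈rows {m = m} {M = M} {f} R v with any? (λ i → v ≟ f i)
  ... | yes (i , refl) = ∈-++⁺ˡ (subst (_∈ _) (sym (row-inside R i)) (∈-map⁺ (λ i → tabulate (M i)) (∈-allFin i)))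
  ... | no ∄i = ∈-++⁺ʳ _ (row-outside λ i e → ∄i (i , e))

  add-row : {M : Mat m} {f : Fin m → Fin n} → Realises G M f → ∀ v → Realises G (M ▹ row G f v) (v ◃ f)
  add-row R v = add v _ (λ i → sym (lookup∘tabulate _ i)) R

  all-true : (p : Fin m → Bool) → (∀ i → p i ≡ true) → all p (allFin m) ≡ true
  all-true p h = go (allFin _)
    where
    go : ∀ xs → all p xs ≡ true
    go []       = refl
    go (x ∷ xs) = ∧-join (h x) (go xs)

  realised-admissible : ∀ ps {N : Mat (suc m)} {f} → FreeOf ps G → Realises G N f → admissible ps N ≡ true
  realised-admissible ps {N} {f} free R = ∧-join
    (all-true _ λ i → all-true _ λ j → ∧-join (equal zero (suc i) (suc j))
      (implies (N (suc i) (suc j) == same) λ e → ≡⇒== (N-sym (suc i) (suc j) (==⇒≡ e))))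
    (cong not (¬-not (clash ps free R)))
    where
    implies : ∀ a {b} → (a ≡ true → b ≡ true) → not a ∨ b ≡ true
    implies false h = refl
    implies true  h = h refl
    ≡⇒== : ∀ {r s} → r ≡ s → (r == s) ≡ true
    ≡⇒== {r} refl = ==-refl r
    f≡ : ∀ {i j} → N i j ≡ same → f i ≡ f j
    f≡ e = rel-same G (trans (relations R _ _) e)
    equal : ∀ i j l → not (N i j == same) ∨ (N i l == N j l) ≡ true
    equal i j l = implies (N i j == same) λ e → ≡⇒==
      (trans (sym (relations R i l)) (trans (cong (λ u → rel G u (f l)) (f≡ (==⇒≡ e))) (relations R j l)))
    N-sym : ∀ i j → N i j ≡ same → N zero i ≡ N zero j
    N-sym i j e = trans (sym (relations R zero i)) (trans (cong (rel G (f zero)) (f≡ e)) (relations R zero j))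

-- Forcing: what the absence of patterns says about vertices added to a configuration

good : List Pattern → Mat m → List (Vec Rel m)
good ps M = filterᵇ (λ r → admissible ps (M ▹ r)) (rows M)

allPairs : (A → A → Bool) → List A → Bool
allPairs p xs = all (λ x → all (p x) xs) xs

-- The template stands to the left of `∨`, so that evaluation searches for forbidden patterns only
-- for those pairs of rows that violate it.
compatible : List Pattern → Mat m → (A → A → Bool → Bool) → (Vec Rel m → A) → Bool
compatible ps M R lab = allPairs (λ r r′ → all (pairTest r r′) bools) (good ps M)
  where
  pairTest : Vec Rel _ → Vec Rel _ → Bool → Bool
  pairTest r r′ b = R (lab r) (lab r′) b ∨ not (admissible ps ((M ▹ r′) ▹ (⟦ b ⟧ ∷ r)))

-- All ways in which a copy of `Q` can lie relative to the configuration, pruned after each vertex.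
-- An empty list means that the two cannot occur in the same graph.
survivors : List Pattern → Mat m → Adjacency k → List (Mat (k + m))
survivors {m} ps M = go (good ps M)
  where
  go : List (Vec Rel m) → Adjacency k → List (Mat (k + m))
  go {zero}  rs Q = M ∷ []
  go {suc k} rs Q = filterᵇ (admissible ps)
    (cartesianProductWith (λ N r → N ▹ (tabulate (λ j → ⟦ Q zero (suc j) ⟧) ++ᵛ r))
      (go rs (λ i j → Q (suc i) (suc j))) rs)

module _ {G : Graph n} ps (free : FreeOf ps G) {M : Mat m} {f : Fin m → Fin n} (R : Realises G M f) where

  row∈good : ∀ v → row G f v ∈ good ps M
  row∈good v = ∈-filterᵇ _ (row∈rows R v) (realised-admissible ps free (add-row R v))

  compatible-labels : (C : A → A → Bool → Bool) (lab : Vec Rel m → A) → compatible ps M C lab ≡ true →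
    ∀ u v → u ≢ v → C (lab (row G f u)) (lab (row G f v)) (adj G u v) ≡ true
  compatible-labels C lab e u v u≢v = ∨-resolve
    (all-∈ (λ b → C (lab (row G f u)) (lab (row G f v)) b ∨ not (admissible ps (N ▹ (⟦ b ⟧ ∷ row G f u))))
      (all-∈ _ (all-∈ _ e (row∈good u)) (row∈good v)) (∈-bools (adj G u v)))
    (cong not (realised-admissible ps free (add u (⟦ adj G u v ⟧ ∷ row G f u) rel-u (add-row R v))))
    where
    N = M ▹ row G f v
    rel-u : ∀ i → rel G u ((v ◃ f) i) ≡ lookup (⟦ adj G u v ⟧ ∷ row G f u) i
    rel-u zero    = rel-≢ G u≢v
    rel-u (suc i) = sym (lookup∘tabulate _ i)

  excluded : (Q : Adjacency k) → null (survivors ps M Q) ≡ true → ¬ InducedIn Q G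
  excluded Q e h = ∈-null e (proj₁ (proj₂ (survive Q (proj₁ h) (induced-rel {G = G} h))))
    where
    glue : (Fin k → Fin n) → Fin (k + m) → Fin n
    glue {zero}  g = f
    glue {suc k} g = g zero ◃ glue (g ∘ suc)
    glue-rel : ∀ v (g : Fin k → Fin n) {q} → (∀ i → rel G v (g i) ≡ q i) →
      ∀ i → rel G v (glue g i) ≡ lookup (tabulate q ++ᵛ row G f v) i
    glue-rel {zero}  v g h i       = sym (lookup∘tabulate _ i)
    glue-rel {suc k} v g h zero    = h zero
    glue-rel {suc k} v g h (suc i) = glue-rel v (g ∘ suc) (h ∘ suc) i
    survive : (Q : Adjacency k) (g : Fin k → Fin n) → (∀ i j → i ≢ j → rel G (g i) (g j) ≡ ⟦ Q i j ⟧) →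
      ∃ λ N → N ∈ survivors ps M Q × Realises G N (glue g)
    survive {zero}  Q g h = M , here refl , R
    survive {suc k} Q g h with N , i , S ← survive (λ i j → Q (suc i) (suc j)) (g ∘ suc) (λ i j i≢j → h _ _ (i≢j ∘ suc-injective)) =
      _ , ∈-filterᵇ _ (∈-cartesianProductWith⁺ _ i (row∈good (g zero))) (realised-admissible ps free S′) , S′
      where S′ = add (g zero) _ (glue-rel (g zero) (g ∘ suc) (λ i → h zero (suc i) λ ())) S

forced : (G : Graph n) (ps : List Pattern) → FreeOf ps G → (P : Adjacency m) (C : A → A → Bool → Bool) (lab : Vec Rel m → A) →
  compatible ps (matrix P) C lab ≡ true → (h : InducedIn P G) → let ℓ = λ v → lab (row G (proj₁ h) v) in
  ∀ u v → u ≢ v → C (ℓ u) (ℓ v) (adj G u v) ≡ true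
forced G ps free P C lab ok h = compatible-labels ps free (induced-realises {G = G} {P = P} h) C lab ok

absent : (G : Graph n) (ps : List Pattern) → FreeOf ps G → (P : Adjacency m) (Q : Adjacency k) →
  null (survivors ps (matrix P) Q) ≡ true → InducedIn P G → ¬ InducedIn Q G
absent G ps free P Q ok h = excluded {G = G} ps free (induced-realises {G = G} {P = P} h) Q ok

-- The forbidden graphs and the seeds of the classes 𝒜 and 𝒞

pattern o = false
pattern I = true

cone : Adjacency k → Subset k → Adjacency (suc k)
cone P S zero    zero    = false
cone P S zero    (suc j) = lookup S j
cone P S (suc i) zero    = lookup S i
cone P S (suc i) (suc j) = P i j

C4 house : Adjacency _
C4    = cycleAdj 4
house = cone C4 (I ∷ I ∷ o ∷ o ∷ [])

-- A seed is a hole a, b, c, d with two further vertices p and q, in the order q, p, a, b, c, d.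
seedA : Bool → Adjacency 6
seedA ec = cone (cone C4 (o ∷ o ∷ I ∷ I ∷ [])) (I ∷ o ∷ o ∷ ec ∷ o ∷ [])

-- The matching is formed by the edges ad and bc of the hole. The cliques are {a, b} and {c, d, p,
-- q} in `seedC₁`, and {a, b, q} and {c, d, p} in `seedC₂`.
seedC₁ seedC₂ : Adjacency 6
seedC₁ = cone (cone C4 (o ∷ o ∷ I ∷ I ∷ [])) (I ∷ o ∷ o ∷ I ∷ I ∷ [])
seedC₂ = cone (cone C4 (o ∷ o ∷ I ∷ I ∷ [])) (o ∷ I ∷ I ∷ o ∷ o ∷ [])

withCo : List Pattern → List Pattern
withCo []             = []
withCo ((k , P) ∷ ps) = (k , P) ∷ (k , co P) ∷ withCo ps

-- Up to symmetry these are the two wheels with rim C₄, and the two holes. `withCo` adds P₃ + K₂,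
-- 2K₂ + K₁ and the complement of C₆; C₅ is its own complement.
basic seedsA seedsC allPatterns : List Pattern
basic  = (5 , wheelAdj 4 (I ∷ I ∷ I ∷ o ∷ [])) ∷ (5 , wheelAdj 4 (I ∷ I ∷ I ∷ I ∷ [])) ∷
         (5 , cycleAdj 5) ∷ (6 , cycleAdj 6) ∷ []
seedsA = (6 , seedA false) ∷ (6 , seedA true) ∷ []
seedsC = (6 , seedC₁) ∷ (6 , seedC₂) ∷ []
allPatterns = basic ++ seedsA ++ seedsC

weaken : (G : Graph n) (xs ys : List Pattern) → FreeOf (withCo (xs ++ ys)) G → FreeOf (withCo xs) G
weaken G []       ys _            = []
weaken G (_ ∷ xs) ys (p ∷ q ∷ ps) = p ∷ q ∷ weaken G xs ys ps

weakenʳ : (G : Graph n) (xs ys : List Pattern) → FreeOf (withCo (xs ++ ys)) G → FreeOf (withCo ys) G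
weakenʳ G []       ys ps           = ps
weakenʳ G (_ ∷ xs) ys (_ ∷ _ ∷ ps) = weakenʳ G xs ys ps

free-++ : (G : Graph n) (xs ys : List Pattern) → FreeOf (withCo xs) G → FreeOf (withCo ys) G → FreeOf (withCo (xs ++ ys)) G
free-++ G []       ys _            qs = qs
free-++ G (_ ∷ xs) ys (p ∷ q ∷ ps) qs = p ∷ q ∷ free-++ G xs ys ps qs

-- Specifications of the classes by adjacency tables

data Spec : Set where
  ∗ ✗ 𝟘 𝟙 : Spec

allows : Spec → Bool → Bool
allows ∗ b = true
allows ✗ b = false
allows 𝟘 b = not b
allows 𝟙 b = b

Template : Set → Set
Template A = A → A → Bool → Bool

table : Vec (Vec Spec k) k → Template (Fin k)
table t i j = allows (lookup (lookup t i) j)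

must : Bool → Spec
must true  = 𝟙
must false = 𝟘

-- Columns: K, S.
splitT : Template (Fin 2)
splitT = table ((𝟙 ∷ ∗ ∷ []) ∷ (∗ ∷ 𝟘 ∷ []) ∷ [])

-- Columns: a, b, c, d, e, X.
templateA : Bool → Bool → Template (Fin 6)
templateA ec ed = table
  ( (✗ ∷ 𝟙 ∷ 𝟘 ∷ 𝟙 ∷ 𝟘 ∷ 𝟘 ∷ [])
  ∷ (𝟙 ∷ ✗ ∷ 𝟙 ∷ 𝟘 ∷ 𝟘 ∷ 𝟘 ∷ [])
  ∷ (𝟘 ∷ 𝟙 ∷ ✗ ∷ 𝟙 ∷ must ec ∷ 𝟙 ∷ [])
  ∷ (𝟙 ∷ 𝟘 ∷ 𝟙 ∷ ✗ ∷ must ed ∷ 𝟙 ∷ [])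
  ∷ (𝟘 ∷ 𝟘 ∷ must ec ∷ must ed ∷ ✗ ∷ 𝟙 ∷ [])
  ∷ (𝟘 ∷ 𝟘 ∷ 𝟙 ∷ 𝟙 ∷ 𝟙 ∷ 𝟙 ∷ []) ∷ [])

-- Columns: x₁, x₂, y₁, y₂, and the remaining vertices of X and of Y.
templateC : Template (Fin 6)
templateC = table
  ( (✗ ∷ 𝟙 ∷ 𝟙 ∷ 𝟘 ∷ 𝟙 ∷ 𝟘 ∷ [])
  ∷ (𝟙 ∷ ✗ ∷ 𝟘 ∷ 𝟙 ∷ 𝟙 ∷ 𝟘 ∷ [])
  ∷ (𝟙 ∷ 𝟘 ∷ ✗ ∷ 𝟙 ∷ 𝟘 ∷ 𝟙 ∷ [])
  ∷ (𝟘 ∷ 𝟙 ∷ 𝟙 ∷ ✗ ∷ 𝟘 ∷ 𝟙 ∷ [])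
  ∷ (𝟙 ∷ 𝟙 ∷ 𝟘 ∷ 𝟘 ∷ 𝟙 ∷ 𝟘 ∷ [])
  ∷ (𝟘 ∷ 𝟘 ∷ 𝟙 ∷ 𝟙 ∷ 𝟘 ∷ 𝟙 ∷ []) ∷ [])

-- Columns: x, y, the remaining vertices of X and of Y, Z, W.
weakB : Template (Fin 6)
weakB = table
  ( (✗ ∷ 𝟙 ∷ 𝟘 ∷ 𝟙 ∷ 𝟙 ∷ 𝟘 ∷ [])
  ∷ (𝟙 ∷ ✗ ∷ 𝟙 ∷ 𝟘 ∷ 𝟙 ∷ 𝟘 ∷ [])
  ∷ (𝟘 ∷ 𝟙 ∷ 𝟘 ∷ ∗ ∷ 𝟘 ∷ ∗ ∷ [])
  ∷ (𝟙 ∷ 𝟘 ∷ ∗ ∷ 𝟘 ∷ 𝟘 ∷ ∗ ∷ [])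
  ∷ (𝟙 ∷ 𝟙 ∷ 𝟘 ∷ 𝟘 ∷ 𝟘 ∷ ∗ ∷ [])
  ∷ (𝟘 ∷ 𝟘 ∷ ∗ ∷ ∗ ∷ ∗ ∷ ∗ ∷ []) ∷ [])

isW : Fin 6 → Bool
isW 5F = true
isW _  = false

-- The condition on W is stated in one order only, because pairs of vertices are tested in both orders.
templateB : Template (Fin 6)
templateB s t b = if isW s then not b else weakB s t b

-- The members of the classes avoid wheels and antiwheels

-- Turns the pairwise conditions of a class with unboundedly large members into one finite table: a
-- pattern is excluded from all members at once if no labelling of its vertices fits the table.
record Labelling (T : Template A) (G : Graph n) : Set where
  constructor labelling
  field
    label : Fin n → A
    fit   : ∀ u v → u ≢ v → T (label u) (label v) (adj G u v) ≡ true
open Labelling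

labelled : {T : Template A} {G : Graph n} (Is : A → Fin n → Set) → (∀ v → ∃ λ s → Is s v) →
  (∀ s t {u v} → Is s u → Is t v → u ≢ v → T s t (adj G u v) ≡ true) → Labelling T G
labelled Is view fits = labelling (proj₁ ∘ view) λ u v → fits _ _ (proj₂ (view u)) (proj₂ (view v))

unrestricted : A → Fin k → Bool
unrestricted _ _ = true

refutes : Template (Fin k) → Adjacency m → (Fin m → Fin k → Bool) → Bool
refutes T P D = not (does (solve (λ i j s t → T s t (P i j)) D))

refuted : {T : Template (Fin k)} {G : Graph n} (ℓ : Labelling T G) (P : Adjacency m) (D : Fin m → Fin k → Bool) →
  refutes T P D ≡ true → ((f , _) : InducedIn P G) → ¬ (∀ i → D i (label ℓ (f i)) ≡ true)
refuted {T = T} ℓ P D e (f , inj , h) d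
  with () ← trans (sym e) (cong not (dec-true (solve (λ i j s t → T s t (P i j)) D)
    (label ℓ ∘ f , d , λ i j i≢j → subst (λ b → T (label ℓ (f i)) (label ℓ (f j)) b ≡ true) (sym (h i j i≢j))
      (fit ℓ _ _ (i≢j ∘ inj)))))

rim : ∀ {S} (G : Graph n) → InducedIn (wheelAdj k S) G → InducedIn (cycleAdj k) G
rim G (f , inj , h) = f ∘ suc , suc-injective ∘ inj , λ i j i≢j → h _ _ (i≢j ∘ suc-injective)

co-rim : ∀ {S} (G : Graph n) → InducedIn (antiwheelAdj k S) G → InducedIn (co (cycleAdj k)) G
co-rim G (f , inj , h) = f ∘ suc , suc-injective ∘ inj , λ i j i≢j → h _ _ (i≢j ∘ suc-injective)

-- Members of the classes may contain a C₄ or a 2K₂, so at rim four the spokes have to be counted.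
-- Larger wheels and antiwheels are excluded through their rims or, where the graph is itself that
-- hole, by its number of vertices.
noSmall : (G : Graph n) →
  (∀ S → 3 ≤ ∣ S ∣ → ¬ InducedIn (wheelAdj 4 S) G × ¬ InducedIn (antiwheelAdj 4 S) G) →
  (∀ S → ¬ InducedIn (wheelAdj 5 S) G × ¬ InducedIn (antiwheelAdj 5 S) G) →
  (∀ S → ¬ InducedIn (wheelAdj 6 S) G × ¬ InducedIn (antiwheelAdj 6 S) G) → NoSmallWheelAntiwheel G
noSmall G h₄ h₅ h₆ =
    (λ { (4 , _ , _ , S , p , w) → proj₁ (h₄ S p) w
       ; (5 , _ , _ , S , p , w) → proj₁ (h₅ S) w
       ; (6 , _ , _ , S , p , w) → proj₁ (h₆ S) w
       ; (suc (suc (suc (suc (suc (suc (suc k)))))) , _ , s≤s (s≤s (s≤s (s≤s (s≤s (s≤s (s≤s ())))))) , _)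
       ; (1 , s≤s () , _) ; (2 , s≤s (s≤s ()) , _) ; (3 , s≤s (s≤s (s≤s ())) , _)  })
  , (λ { (4 , _ , _ , S , p , w) → proj₂ (h₄ S p) w
       ; (5 , _ , _ , S , p , w) → proj₂ (h₅ S) w
       ; (6 , _ , _ , S , p , w) → proj₂ (h₆ S) w
       ; (suc (suc (suc (suc (suc (suc (suc k)))))) , _ , s≤s (s≤s (s≤s (s≤s (s≤s (s≤s (s≤s ())))))) , _)
       ; (1 , s≤s () , _) ; (2 , s≤s (s≤s ()) , _) ; (3 , s≤s (s≤s (s≤s ())) , _)  })

refutes₄ : Template (Fin k) → (Subset 4 → Adjacency 5) → Bool
refutes₄ T F = all (λ S → refutes T (F S) unrestricted ∨ not (3 ≤ᵇ ∣ S ∣)) (vectors bools 4)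

refutesCycle : Template (Fin k) → ℕ → Bool
refutesCycle T m = refutes T (cycleAdj m) unrestricted ∧ refutes T (co (cycleAdj m)) unrestricted

module _ {T : Template (Fin k)} {G : Graph n} (ℓ : Labelling T G) where

  refuted₄ : (F : Subset 4 → Adjacency 5) → refutes₄ T F ≡ true → ∀ S → 3 ≤ ∣ S ∣ → ¬ InducedIn (F S) G
  refuted₄ F e S p w = refuted ℓ (F S) unrestricted
    (∨-resolve (all-∈ (λ S → refutes T (F S) unrestricted ∨ not (3 ≤ᵇ ∣ S ∣)) e (∈-vectors S λ i → ∈-bools _))
      (cong not (Equivalence.to T-≡ (ℕₚ.≤⇒≤ᵇ p))))
    w (λ _ → refl)

  wheels₄-refuted : refutes₄ T (wheelAdj 4) ≡ true → refutes₄ T (antiwheelAdj 4) ≡ true →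
    ∀ S → 3 ≤ ∣ S ∣ → ¬ InducedIn (wheelAdj 4 S) G × ¬ InducedIn (antiwheelAdj 4 S) G
  wheels₄-refuted e₁ e₂ S p = refuted₄ (wheelAdj 4) e₁ S p , refuted₄ (antiwheelAdj 4) e₂ S p

  cycle-refuted : refutesCycle T m ≡ true →
    ∀ S → ¬ InducedIn (wheelAdj m S) G × ¬ InducedIn (antiwheelAdj m S) G
  cycle-refuted {m} e S with a , b ← ∧-split {refutes T (cycleAdj m) unrestricted} e =
    (λ w → refuted ℓ (cycleAdj m) unrestricted a (rim G w) (λ _ → refl)) ,
    (λ w → refuted ℓ (co (cycleAdj m)) unrestricted b (co-rim G w) (λ _ → refl))

  labelled⇒noSmall : refutes₄ T (wheelAdj 4) ≡ true → refutes₄ T (antiwheelAdj 4) ≡ true → refutesCycle T 5 ≡ true → refutesCycle T 6 ≡ true →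
    NoSmallWheelAntiwheel G
  labelled⇒noSmall e₄ e₄′ e₅ e₆ = noSmall G (wheels₄-refuted e₄ e₄′) (cycle-refuted e₅) (cycle-refuted e₆)

hole⇒labelling : (G : Graph n) → IsHole m G → Labelling (λ s t b → matrix (cycleAdj m) s t == ⟦ b ⟧) G
hole⇒labelling {m = m} G (f , inj , onto , h) = labelling (proj₁ ∘ onto) fits
  where
  fits : ∀ u v → u ≢ v → (matrix (cycleAdj m) (proj₁ (onto u)) (proj₁ (onto v)) == ⟦ adj G u v ⟧) ≡ true
  fits u v u≢v with i , refl ← onto u | j , refl ← onto v
    rewrite dec-false (i ≟ j) (u≢v ∘ cong f) | h i j (u≢v ∘ cong f) = ==-refl _

tooLarge : (G : Graph n) {P : Adjacency k} → IsHole m G → m < k → ¬ InducedIn P G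
tooLarge G (f , _ , onto , _) m<k (g , inj , _) = ℕₚ.<⇒≱ m<k (injective⇒≤ {f = proj₁ ∘ onto ∘ g}
  λ {i} {j} e → inj (trans (sym (proj₂ (onto (g i)))) (trans (cong f e) (proj₂ (onto (g j))))))

hole₅⇒noSmall : (G : Graph n) → IsHole 5 G → NoSmallWheelAntiwheel G
hole₅⇒noSmall G h = noSmall G (wheels₄-refuted (hole⇒labelling G h) refl refl)
  (λ S → tooLarge G h (ℕₚ.m≤m+n 6 0) , tooLarge G h (ℕₚ.m≤m+n 6 0))
  (λ S → tooLarge G h (ℕₚ.m≤m+n 6 1) , tooLarge G h (ℕₚ.m≤m+n 6 1))

hole₆⇒noSmall : (G : Graph n) → IsHole 6 G → NoSmallWheelAntiwheel G
hole₆⇒noSmall G h = noSmall G (wheels₄-refuted (hole⇒labelling G h) refl refl) (cycle-refuted (hole⇒labelling G h) refl)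
  (λ S → tooLarge G h (ℕₚ.m≤m+n 7 0) , tooLarge G h (ℕₚ.m≤m+n 7 0))

split⇒noSmall : (G : Graph n) → IsSplit G → NoSmallWheelAntiwheel G
split⇒noSmall {n} G (side , clique , stable) = labelled⇒noSmall {T = splitT} {G} (labelled Is view fits) refl refl refl refl
  where
  Is : Fin 2 → Fin n → Set
  Is 0F v = side v ≡ true
  Is 1F v = side v ≡ false
  view : ∀ v → ∃ λ s → Is s v
  view v with side v in e
  ... | true  = 0F , e
  ... | false = 1F , e
  fits : ∀ s t {u v} → Is s u → Is t v → u ≢ v → splitT s t (adj G u v) ≡ true
  fits 0F 0F p q u≢v = clique _ _ u≢v p q
  fits 0F 1F _ _ _   = refl
  fits 1F 0F _ _ _   = refl
  fits 1F 1F p q _   = cong not (stable _ _ p q)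

must-allows : ∀ b → allows (must b) b ≡ true
must-allows true  = refl
must-allows false = refl

A⇒noSmall : (G : Graph n) → InA G → NoSmallWheelAntiwheel G
A⇒noSmall {n} G (a , b , c , d , e , _ , (ab , bc , cd , da , ac , bd) , _ , X-clique , X-rows , eX , ea , eb , ecd) =
  finish (adj G e c) (adj G e d) ecd (labelled Is view fits)
  where
    ⇄_ : ∀ {u v b} → adj G u v ≡ b → adj G v u ≡ b
    ⇄_ = trans (adj-sym G _ _)
    Is : Fin 6 → Fin n → Set
    Is 0F v = v ≡ a
    Is 1F v = v ≡ b
    Is 2F v = v ≡ c
    Is 3F v = v ≡ d
    Is 4F v = v ≡ e
    Is 5F v = v ≢ a × v ≢ b × v ≢ c × v ≢ d × v ≢ e
    view : ∀ v → ∃ λ s → Is s v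
    view v with v ≟ a | v ≟ b | v ≟ c | v ≟ d | v ≟ e
    ... | yes p | _ | _ | _ | _ = 0F , p
    ... | no _ | yes p | _ | _ | _ = 1F , p
    ... | no _ | no _ | yes p | _ | _ = 2F , p
    ... | no _ | no _ | no _ | yes p | _ = 3F , p
    ... | no _ | no _ | no _ | no _ | yes p = 4F , p
    ... | no p | no q | no r | no s | no t = 5F , p , q , r , s , t
    fits : ∀ s t {u v} → Is s u → Is t v → u ≢ v → templateA (adj G e c) (adj G e d) s t (adj G u v) ≡ true
    fits 0F 0F refl refl u≢v = ⊥-elim (u≢v refl)
    fits 0F 1F refl refl _ = ab
    fits 0F 2F refl refl _ = cong not ac
    fits 0F 3F refl refl _ = ⇄ da
    fits 0F 4F refl refl _ = cong not (⇄ ea)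
    fits 0F 5F refl v _ = cong not (⇄ (proj₁ (proj₂ (proj₂ (X-rows _ v)))))
    fits 1F 0F refl refl _ = ⇄ ab
    fits 1F 1F refl refl u≢v = ⊥-elim (u≢v refl)
    fits 1F 2F refl refl _ = bc
    fits 1F 3F refl refl _ = cong not bd
    fits 1F 4F refl refl _ = cong not (⇄ eb)
    fits 1F 5F refl v _ = cong not (⇄ (proj₂ (proj₂ (proj₂ (X-rows _ v)))))
    fits 2F 0F refl refl _ = cong not (⇄ ac)
    fits 2F 1F refl refl _ = ⇄ bc
    fits 2F 2F refl refl u≢v = ⊥-elim (u≢v refl)
    fits 2F 3F refl refl _ = cd
    fits 2F 4F refl refl _ = subst (λ b → allows (must (adj G e c)) b ≡ true) (adj-sym G e c) (must-allows (adj G e c))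
    fits 2F 5F refl v _ = ⇄ (proj₁ (X-rows _ v))
    fits 3F 0F refl refl _ = da
    fits 3F 1F refl refl _ = cong not (⇄ bd)
    fits 3F 2F refl refl _ = ⇄ cd
    fits 3F 3F refl refl u≢v = ⊥-elim (u≢v refl)
    fits 3F 4F refl refl _ = subst (λ b → allows (must (adj G e d)) b ≡ true) (adj-sym G e d) (must-allows (adj G e d))
    fits 3F 5F refl v _ = ⇄ (proj₁ (proj₂ (X-rows _ v)))
    fits 4F 0F refl refl _ = cong not ea
    fits 4F 1F refl refl _ = cong not eb
    fits 4F 2F refl refl _ = must-allows (adj G e c)
    fits 4F 3F refl refl _ = must-allows (adj G e d)
    fits 4F 4F refl refl u≢v = ⊥-elim (u≢v refl)
    fits 4F 5F refl v _ = eX _ v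
    fits 5F 0F u refl _ = cong not (proj₁ (proj₂ (proj₂ (X-rows _ u))))
    fits 5F 1F u refl _ = cong not (proj₂ (proj₂ (proj₂ (X-rows _ u))))
    fits 5F 2F u refl _ = proj₁ (X-rows _ u)
    fits 5F 3F u refl _ = proj₁ (proj₂ (X-rows _ u))
    fits 5F 4F u refl _ = ⇄ (eX _ u)
    fits 5F 5F u v u≢v = X-clique _ _ u v u≢v
    -- The tables evaluate only when they are closed, so the adjacencies from e to c and d are
    -- generalised to Booleans and split.
    finish : ∀ ec ed → ec ∧ ed ≡ false → Labelling (templateA ec ed) G → NoSmallWheelAntiwheel G
    finish true  true  () ℓ
    finish true  false _  ℓ = labelled⇒noSmall ℓ refl refl refl refl
    finish false true  _  ℓ = labelled⇒noSmall ℓ refl refl refl refl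
    finish false false _  ℓ = labelled⇒noSmall ℓ refl refl refl refl

C⇒noSmall : (G : Graph n) → InC G → NoSmallWheelAntiwheel G
C⇒noSmall {n} G (side , clique , _ , _ , x₁ , x₂ , y₁ , y₂ , sx₁ , sx₂ , sy₁ , sy₂ , x₁≢x₂ , y₁≢y₂ , xy₁ , xy₂ , only) =
  labelled⇒noSmall {T = templateC} {G} (labelled Is view fits) refl refl refl refl
  where
    ⇄_ : ∀ {u v b} → adj G u v ≡ b → adj G v u ≡ b
    ⇄_ = trans (adj-sym G _ _)
    Is : Fin 6 → Fin n → Set
    Is 0F v = v ≡ x₁
    Is 1F v = v ≡ x₂
    Is 2F v = v ≡ y₁
    Is 3F v = v ≡ y₂
    Is 4F v = side v ≡ true × v ≢ x₁ × v ≢ x₂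
    Is 5F v = side v ≡ false × v ≢ y₁ × v ≢ y₂
    view : ∀ v → ∃ λ s → Is s v
    view v with side v in s | v ≟ x₁ | v ≟ x₂ | v ≟ y₁ | v ≟ y₂
    ... | _ | yes p | _ | _ | _ = 0F , p
    ... | _ | no _ | yes p | _ | _ = 1F , p
    ... | _ | no _ | no _ | yes p | _ = 2F , p
    ... | _ | no _ | no _ | no _ | yes p = 3F , p
    ... | true  | no p | no q | no _ | no _ = 4F , s , p , q
    ... | false | no _ | no _ | no p | no q = 5F , s , p , q
    apart : ∀ {u v} → side u ≡ true → side v ≡ false → ¬ (u ≡ x₁ × v ≡ y₁) → ¬ (u ≡ x₂ × v ≡ y₂) → adj G u v ≡ false
    apart {u} {v} su sv ≢₁ ≢₂ with adj G u v in e
    ... | false = refl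
    ... | true with only u v su sv e
    ...   | inj₁ p = ⊥-elim (≢₁ p)
    ...   | inj₂ p = ⊥-elim (≢₂ p)
    fits : ∀ s t {u v} → Is s u → Is t v → u ≢ v → templateC s t (adj G u v) ≡ true
    fits 0F 0F refl refl u≢v = ⊥-elim (u≢v refl)
    fits 0F 1F refl refl u≢v = clique _ _ u≢v (trans sx₁ (sym sx₂))
    fits 0F 2F refl refl _ = xy₁
    fits 0F 3F refl refl _ = cong not (apart sx₁ sy₂ (y₁≢y₂ ∘ sym ∘ proj₂) (x₁≢x₂ ∘ proj₁))
    fits 0F 4F refl (v , _) u≢v = clique _ _ u≢v (trans sx₁ (sym v))
    fits 0F 5F refl (v , v≢₁ , v≢₂) _ = cong not (apart sx₁ v (v≢₁ ∘ proj₂) (v≢₂ ∘ proj₂))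
    fits 1F 0F refl refl u≢v = clique _ _ u≢v (trans sx₂ (sym sx₁))
    fits 1F 1F refl refl u≢v = ⊥-elim (u≢v refl)
    fits 1F 2F refl refl _ = cong not (apart sx₂ sy₁ (x₁≢x₂ ∘ sym ∘ proj₁) (y₁≢y₂ ∘ proj₂))
    fits 1F 3F refl refl _ = xy₂
    fits 1F 4F refl (v , _) u≢v = clique _ _ u≢v (trans sx₂ (sym v))
    fits 1F 5F refl (v , v≢₁ , v≢₂) _ = cong not (apart sx₂ v (v≢₁ ∘ proj₂) (v≢₂ ∘ proj₂))
    fits 2F 0F refl refl _ = ⇄ xy₁
    fits 2F 1F refl refl _ = cong not (⇄ (apart sx₂ sy₁ (x₁≢x₂ ∘ sym ∘ proj₁) (y₁≢y₂ ∘ proj₂)))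
    fits 2F 2F refl refl u≢v = ⊥-elim (u≢v refl)
    fits 2F 3F refl refl u≢v = clique _ _ u≢v (trans sy₁ (sym sy₂))
    fits 2F 4F refl (v , v≢₁ , v≢₂) _ = cong not (⇄ (apart v sy₁ (v≢₁ ∘ proj₁) (v≢₂ ∘ proj₁)))
    fits 2F 5F refl (v , _) u≢v = clique _ _ u≢v (trans sy₁ (sym v))
    fits 3F 0F refl refl _ = cong not (⇄ (apart sx₁ sy₂ (y₁≢y₂ ∘ sym ∘ proj₂) (x₁≢x₂ ∘ proj₁)))
    fits 3F 1F refl refl _ = ⇄ xy₂
    fits 3F 2F refl refl u≢v = clique _ _ u≢v (trans sy₂ (sym sy₁))
    fits 3F 3F refl refl u≢v = ⊥-elim (u≢v refl)
    fits 3F 4F refl (v , v≢₁ , v≢₂) _ = cong not (⇄ (apart v sy₂ (v≢₁ ∘ proj₁) (v≢₂ ∘ proj₁)))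
    fits 3F 5F refl (v , _) u≢v = clique _ _ u≢v (trans sy₂ (sym v))
    fits 4F 0F (u , _) refl u≢v = clique _ _ u≢v (trans u (sym sx₁))
    fits 4F 1F (u , _) refl u≢v = clique _ _ u≢v (trans u (sym sx₂))
    fits 4F 2F (u , u≢₁ , u≢₂) refl _ = cong not (apart u sy₁ (u≢₁ ∘ proj₁) (u≢₂ ∘ proj₁))
    fits 4F 3F (u , u≢₁ , u≢₂) refl _ = cong not (apart u sy₂ (u≢₁ ∘ proj₁) (u≢₂ ∘ proj₁))
    fits 4F 4F (u , _) (v , _) u≢v = clique _ _ u≢v (trans u (sym v))
    fits 4F 5F (u , u≢₁ , u≢₂) (v , _) _ = cong not (apart u v (u≢₁ ∘ proj₁) (u≢₂ ∘ proj₁))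
    fits 5F 0F (u , u≢₁ , u≢₂) refl _ = cong not (⇄ (apart sx₁ u (u≢₁ ∘ proj₂) (u≢₂ ∘ proj₂)))
    fits 5F 1F (u , u≢₁ , u≢₂) refl _ = cong not (⇄ (apart sx₂ u (u≢₁ ∘ proj₂) (u≢₂ ∘ proj₂)))
    fits 5F 2F (u , _) refl u≢v = clique _ _ u≢v (trans u (sym sy₁))
    fits 5F 3F (u , _) refl u≢v = clique _ _ u≢v (trans u (sym sy₂))
    fits 5F 4F (u , _) (v , v≢₁ , v≢₂) _ = cong not (⇄ (apart v u (v≢₁ ∘ proj₁) (v≢₂ ∘ proj₁)))
    fits 5F 5F (u , _) (v , _) u≢v = clique _ _ u≢v (trans u (sym v))

-- A 2K₂ of a member of ℬ misses x, y, Z and W, so that it forms a P₅ with x.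
B⇒noSmall : (G : Graph n) → InB G → NoSmallWheelAntiwheel G
B⇒noSmall {n} G (L , x , y , Lx , Ly , stable , _ , _ , _ , noP₅ , W-rest , xY , yX , Zxy , Z-rest) =
  noSmall G (λ S p → refuted₄ ℓ (wheelAdj 4) refl S p , λ a → no2K₂ (co-rim G a))
    (cycle-refuted ℓ refl)
    (λ S → (λ w → no2K₂ (subpattern {G = G} (cycleAdj 6) refl (rim G w))) , λ w → refuted ℓ (co (cycleAdj 6)) unrestricted refl (co-rim G w) (λ _ → refl))
  where
    ⇄_ : ∀ {u v b} → adj G u v ≡ b → adj G v u ≡ b
    ⇄_ = trans (adj-sym G _ _)
    Is : Fin 6 → Fin n → Set
    Is 0F v = v ≡ x
    Is 1F v = v ≡ y
    Is 2F v = L v ≡ pX × v ≢ x × v ≢ y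
    Is 3F v = L v ≡ pY × v ≢ x × v ≢ y
    Is 4F v = L v ≡ pZ
    Is 5F v = L v ≡ pW
    view : ∀ v → ∃ λ s → Is s v
    view v with v ≟ x | v ≟ y | L v in l
    ... | yes p | _     | _  = 0F , p
    ... | no _  | yes p | _  = 1F , p
    ... | no p  | no q  | pX = 2F , l , p , q
    ... | no p  | no q  | pY = 3F , l , p , q
    ... | no _  | no _  | pZ = 4F , l
    ... | no _  | no _  | pW = 5F , l
    isolated : ∀ {u v s} → L u ≡ pW → L v ≡ s → s ≢ pW → adj G u v ≡ false
    isolated p refl q = W-rest _ _ p q
    fits : ∀ s t {u v} → Is s u → Is t v → u ≢ v → templateB s t (adj G u v) ≡ true
    fits 0F 0F refl refl u≢v = ⊥-elim (u≢v refl)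
    fits 0F 1F refl refl _ = xY _ Ly
    fits 0F 2F refl (v , _) _ = cong not (stable _ _ (trans Lx (sym v)))
    fits 0F 3F refl (v , _) _ = xY _ v
    fits 0F 4F refl v _ = ⇄ proj₁ (Zxy _ v)
    fits 0F 5F refl v _ = cong not (⇄ isolated v Lx λ ())
    fits 1F 0F refl refl _ = ⇄ xY _ Ly
    fits 1F 1F refl refl u≢v = ⊥-elim (u≢v refl)
    fits 1F 2F refl (v , _) _ = yX _ v
    fits 1F 3F refl (v , _) _ = cong not (stable _ _ (trans Ly (sym v)))
    fits 1F 4F refl v _ = ⇄ proj₂ (Zxy _ v)
    fits 1F 5F refl v _ = cong not (⇄ isolated v Ly λ ())
    fits 2F 0F (u , _) refl _ = cong not (stable _ _ (trans u (sym Lx)))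
    fits 2F 1F (u , _) refl _ = ⇄ yX _ u
    fits 2F 2F (u , _) (v , _) _ = cong not (stable _ _ (trans u (sym v)))
    fits 2F 3F _ _ _ = refl
    fits 2F 4F (u , u≢x , u≢y) v _ = cong not (⇄ Z-rest _ _ v (inj₁ u) u≢x u≢y)
    fits 2F 5F _ _ _ = refl
    fits 3F 0F (u , _) refl _ = ⇄ xY _ u
    fits 3F 1F (u , _) refl _ = cong not (stable _ _ (trans u (sym Ly)))
    fits 3F 2F _ _ _ = refl
    fits 3F 3F (u , _) (v , _) _ = cong not (stable _ _ (trans u (sym v)))
    fits 3F 4F (u , u≢x , u≢y) v _ = cong not (⇄ Z-rest _ _ v (inj₂ u) u≢x u≢y)
    fits 3F 5F _ _ _ = refl
    fits 4F 0F u refl _ = proj₁ (Zxy _ u)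
    fits 4F 1F u refl _ = proj₂ (Zxy _ u)
    fits 4F 2F u (v , v≢x , v≢y) _ = cong not (Z-rest _ _ u (inj₁ v) v≢x v≢y)
    fits 4F 3F u (v , v≢x , v≢y) _ = cong not (Z-rest _ _ u (inj₂ v) v≢x v≢y)
    fits 4F 4F u v _ = cong not (stable _ _ (trans u (sym v)))
    fits 4F 5F _ _ _ = refl
    fits 5F 0F u refl _ = cong not (isolated u Lx λ ())
    fits 5F 1F u refl _ = cong not (isolated u Ly λ ())
    fits 5F 2F u (v , _) _ = cong not (isolated u v λ ())
    fits 5F 3F u (v , _) _ = cong not (isolated u v λ ())
    fits 5F 4F u v _ = cong not (isolated u v λ ())
    fits 5F 5F u v _ = cong not (stable _ _ (trans u (sym v)))
    ℓ : Labelling templateB G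
    ℓ = labelled Is view fits
    XY : Fin n → Set
    XY v = L v ≡ pX ⊎ L v ≡ pY
    no2K₂ : ¬ InducedIn (co C4) G
    no2K₂ h@(f , _) = finish (inner 0F) (inner 1F) (inner 2F) (inner 3F)
      where
      R : Realises G (matrix (co C4)) f
      R = induced-realises h
      unless : Fin 4 → Fin 6 → Fin 4 → Fin 6 → Bool
      unless i s j t = not (does (i ≟ j)) ∨ does (s ≟ t)
      Inner : Bool → Fin 4 → Set
      Inner b i = XY (f i) × label ℓ (f i) ≡ (if b then 3F else 2F) × rel G x (f i) ≡ ⟦ b ⟧
      at : ∀ i s → label ℓ (f i) ≡ s → ∀ j → unless i s j (label ℓ (f j)) ≡ true
      at i s e j with i ≟ j
      ... | no  _    = refl
      ... | yes refl = dec-true (s ≟ _) (sym e)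
      impossible : ∀ i s → label ℓ (f i) ≡ s →
        all (λ i → refutes templateB (co C4) (unless i s)) (allFin 4) ≡ true → ⊥
      -- The domain `unless i s` fixes the label of the `i`-th vertex of the 2K₂ to `s` and leaves
      -- the other three free.
      impossible i s e r = refuted ℓ (co C4) (unless i s)
        (all-∈ (λ i → refutes templateB (co C4) (unless i s)) r (∈-allFin i)) h (at i s e)
      inner : ∀ i → ∃ λ b → Inner b i
      inner i with view (f i) in e
      ... | 2F , l , ≢x , _ = false , inj₁ l , refl , rel-none G (≢x ∘ sym) (stable _ _ (trans Lx (sym l)))
      ... | 3F , l , _      = true  , inj₂ l , refl , rel-edge G (xY _ l)
      ... | 0F , _ = ⊥-elim (impossible i 0F (cong proj₁ e) refl)
      ... | 1F , _ = ⊥-elim (impossible i 1F (cong proj₁ e) refl)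
      ... | 4F , _ = ⊥-elim (impossible i 4F (cong proj₁ e) refl)
      ... | 5F , _ = ⊥-elim (impossible i 5F (cong proj₁ e) refl)
      contra : ∀ i j → matrix (co C4) i j ≡ edge → templateB (label ℓ (f i)) (label ℓ (f j)) true ≡ true
      contra i j e with ≢ , a ← rel-⟦⟧ G {b = true} (trans (relations R i j) e) =
        subst (λ b → templateB (label ℓ (f i)) (label ℓ (f j)) b ≡ true) a (fit ℓ _ _ ≢)
      finish : ∃ (λ b → Inner b 0F) → ∃ (λ b → Inner b 1F) → ∃ (λ b → Inner b 2F) → ∃ (λ b → Inner b 3F) → ⊥
      finish (b₀ , p₀ , l₀ , r₀) (b₁ , p₁ , l₁ , r₁) (b₂ , p₂ , l₂ , r₂) (b₃ , p₃ , l₃ , r₃) =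
        go b₀ b₁ b₂ b₃ (subst₂ (λ s t → templateB s t true ≡ true) l₀ l₂ (contra 0F 2F refl))
          (subst₂ (λ s t → templateB s t true ≡ true) l₁ l₃ (contra 1F 3F refl))
          (add x (⟦ b₀ ⟧ ∷ ⟦ b₁ ⟧ ∷ ⟦ b₂ ⟧ ∷ ⟦ b₃ ⟧ ∷ []) (λ { 0F → r₀ ; 1F → r₁ ; 2F → r₂ ; 3F → r₃ }) R)
        where
        inside : ∀ i → XY ((x ◃ f) i)
        inside 0F = inj₁ Lx
        inside 1F = p₀
        inside 2F = p₁
        inside 3F = p₂
        inside 4F = p₃
        go : ∀ b₀ b₁ b₂ b₃ → templateB (if b₀ then 3F else 2F) (if b₂ then 3F else 2F) true ≡ true →
          templateB (if b₁ then 3F else 2F) (if b₃ then 3F else 2F) true ≡ true →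
          Realises G (matrix (co C4) ▹ (⟦ b₀ ⟧ ∷ ⟦ b₁ ⟧ ∷ ⟦ b₂ ⟧ ∷ ⟦ b₃ ⟧ ∷ [])) (x ◃ f) → ⊥
        go true  true  false false _ _ S = noP₅ (occurs-inside XY inside S refl)
        go true  false false true  _ _ S = noP₅ (occurs-inside XY inside S refl)
        go false true  true  false _ _ S = noP₅ (occurs-inside XY inside S refl)
        go false false true  true  _ _ S = noP₅ (occurs-inside XY inside S refl)
        go true  _ true  _ () _ _
        go false _ false _ () _ _
        go _ true  _ true  _ () _
        go _ false _ false _ () _

-- Labels read off from the relations to a seed.

labelA labelC : Vec Rel 6 → Fin 6
labelA r = if lookup r 2F == same then 0F else
           if lookup r 3F == same then 1F else
           if lookup r 4F == same then 2F else
           if lookup r 5F == same then 3F else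
           -- The vertex p, at index 1, has no label of its own: it is one of the members of X.
           if lookup r 0F == same then 4F else 5F
labelC r = if lookup r 2F == same then 0F else
           if lookup r 3F == same then 1F else
           -- Here d precedes c, because y₁ is the partner of x₁ = a in the matching.
           if lookup r 5F == same then 2F else
           if lookup r 4F == same then 3F else
           if lookup r 2F == edge then 4F else 5F

-- In ℬ the part of a vertex other than x and y is determined by its adjacencies to these two: X
-- sees only y, Y sees only x, Z sees both and W neither.
labelB : Rel → Rel → Fin 6
labelB same _    = 0F
labelB _    same = 1F
labelB none edge = 2F
labelB edge none = 3F
labelB edge edge = 4F
labelB none none = 5F

K3 : Adjacency 3
K3 i j = true

-- Core vertices see two opposite vertices of the hole, so that they can replace a vertex of the
-- hole. The vertices of the hole are themselves in the core.
core : Vec Rel 4 → Bool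
core r = ((lookup r 0F == edge) ∧ (lookup r 2F == edge)) ∨ ((lookup r 1F == edge) ∧ (lookup r 3F == edge))

coverT : Template Bool
coverT s t b = not b ∨ (s ∨ t)

-- The complement of the house, a P₅, remains allowed: the case distinction is on houses in G alone.
withHouse : List Pattern → List Pattern
withHouse ps = (5 , house) ∷ withCo ps

-- The forcing statements, proved by evaluation.

seedA-forces : ∀ ec → compatible (withCo basic) (matrix (seedA ec)) (templateA ec false) labelA ≡ true
seedA-forces true  = refl
seedA-forces false = refl

-- The seeds of 𝒜 must be forbidden here. Two vertices of X in a member of 𝒜 form a `seedC₁`
-- together with a, b, c, d, and the vertex e of that member fits into neither clique.
seedC₁-forces : compatible (withCo (basic ++ seedsA)) (matrix seedC₁) templateC labelC ≡ true
seedC₁-forces = refl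

seedC₂-forces : compatible (withCo (basic ++ seedsA)) (matrix seedC₂) templateC labelC ≡ true
seedC₂-forces = refl

house-forces : compatible (withCo allPatterns) (matrix house) templateB
  (λ r → labelB (lookup r 1F) (lookup r 2F)) ≡ true
house-forces = refl

C4-forces-triangle-free : null (survivors (withHouse basic) (matrix C4) K3) ≡ true
C4-forces-triangle-free = refl

C4-forces-cover : compatible (withHouse allPatterns) (matrix C4) coverT core ≡ true
C4-forces-cover = refl

-- From a seed to membership in 𝒜.

≢⇒¬same : (G : Graph n) → ∀ {u v} → u ≢ v → (rel G u v == same) ≡ false
≢⇒¬same G {u} {v} u≢v = ¬-not (u≢v ∘ rel-same G ∘ ==⇒≡)

-- The entry for e and d is `false` in both seeds: the reflection of the hole that exchanges a with
-- b and c with d allows a neighbour of e in {c, d} to be called c.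
seedA⇒A : (G : Graph n) → FreeOf (withCo basic) G → ∀ ec → InducedIn (seedA ec) G → InA G
seedA⇒A {n} G free ec h@(f , inj , adj-f) =
  f 2F , f 3F , f 4F , f 5F , f 0F ,
  (ne (λ ()) , ne (λ ()) , ne (λ ()) , ne (λ ()) , ne (λ ()) , ne (λ ()) , ne (λ ()) , ne (λ ()) , ne (λ ()) , ne (λ ())) ,
  (ad 2F 3F (λ ()) , ad 3F 4F (λ ()) , ad 4F 5F (λ ()) , ad 5F 2F (λ ()) , ad 2F 4F (λ ()) , ad 3F 5F (λ ())) ,
  (f 1F , ne (λ ()) , ne (λ ()) , ne (λ ()) , ne (λ ()) , ne (λ ())) ,
  (λ u v Xu Xv u≢v → subst₂ (λ s t → templateA ec false s t (adj G u v) ≡ true) (X-label Xu) (X-label Xv) (fits u v u≢v)) ,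
  (λ v Xv@(≢a , ≢b , ≢c , ≢d , ≢e) →
    X-fits Xv 4F ≢c , X-fits Xv 5F ≢d , off (X-fits Xv 2F ≢a) , off (X-fits Xv 3F ≢b)) ,
  (λ v Xv@(_ , _ , _ , _ , ≢e) → trans (adj-sym G _ _)
    (subst (λ t → templateA ec false 5F t (adj G v (f 0F)) ≡ true) (e-label ec) (X-fits Xv 0F ≢e))) ,
  ad 0F 2F (λ ()) , ad 0F 3F (λ ()) ,
  trans (cong (adj G (f 0F) (f 4F) ∧_) (ad 0F 5F (λ ()))) (∧-zeroʳ _)
  where
  R : Realises G (matrix (seedA ec)) f
  R = induced-realises h
  ne : ∀ {i j} → i ≢ j → f i ≢ f j
  ne i≢j e = i≢j (inj e)
  ad : ∀ i j → i ≢ j → adj G (f i) (f j) ≡ seedA ec i j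
  ad i j i≢j = sym (adj-f i j i≢j)
  fits : ∀ u v → u ≢ v → templateA ec false (labelA (row G f u)) (labelA (row G f v)) (adj G u v) ≡ true
  fits = forced G (withCo basic) free (seedA ec) (templateA ec false) labelA (seedA-forces ec) h
  InX : Fin n → Set
  InX v = v ≢ f 2F × v ≢ f 3F × v ≢ f 4F × v ≢ f 5F × v ≢ f 0F
  X-label : ∀ {v} → InX v → labelA (row G f v) ≡ 5F
  X-label (≢a , ≢b , ≢c , ≢d , ≢e)
    rewrite ≢⇒¬same G ≢a | ≢⇒¬same G ≢b | ≢⇒¬same G ≢c | ≢⇒¬same G ≢d | ≢⇒¬same G ≢e = refl
  X-fits : ∀ {v} → InX v → ∀ i → v ≢ f i →
    templateA ec false 5F (labelA (tabulate (matrix (seedA ec) i))) (adj G v (f i)) ≡ true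
  X-fits {v} Xv i v≢ = subst₂ (λ s t → templateA ec false s t (adj G v (f i)) ≡ true)
    (X-label Xv) (cong labelA (row-inside R i)) (fits v (f i) v≢)
  e-label : ∀ ec → labelA (tabulate (matrix (seedA ec) 0F)) ≡ 4F
  e-label true  = refl
  e-label false = refl

-- From a seed to membership in 𝒞.

sideC : Fin 6 → Bool
sideC 0F = true
sideC 1F = true
sideC 4F = true
sideC _  = false

Matched : Fin 6 → Fin 6 → Set
Matched s t = (s ≡ 0F × t ≡ 2F) ⊎ (s ≡ 1F × t ≡ 3F)

templateC-clique : ∀ s t → sideC s ≡ sideC t → templateC s t false ≡ false
templateC-clique s t e = off (∨-resolve
  (all-∈ (λ t → not (templateC s t false) ∨ (sideC s xor sideC t))
    (all-∈ (λ s → all (λ t → not (templateC s t false) ∨ (sideC s xor sideC t)) (allFin 6)) {allFin 6} refl (∈-allFin s))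
    (∈-allFin t))
  (trans (cong (_xor sideC t) e) (xor-same (sideC t))))

templateC-matching : ∀ s t → sideC s ≡ true → sideC t ≡ false → templateC s t true ≡ true → Matched s t
templateC-matching 0F 2F _ _ _ = inj₁ (refl , refl)
templateC-matching 1F 3F _ _ _ = inj₂ (refl , refl)
templateC-matching 2F _ ()
templateC-matching 3F _ ()
templateC-matching 5F _ ()
templateC-matching _ 0F _ ()
templateC-matching _ 1F _ ()
templateC-matching _ 4F _ ()
templateC-matching 0F 3F _ _ ()
templateC-matching 0F 5F _ _ ()
templateC-matching 1F 2F _ _ ()
templateC-matching 1F 5F _ _ ()
templateC-matching 4F 2F _ _ ()
templateC-matching 4F 3F _ _ ()
templateC-matching 4F 5F _ _ ()

labelC-same : ∀ r → let s = labelC r in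
  (s ≡ 0F → lookup r 2F ≡ same) × (s ≡ 1F → lookup r 3F ≡ same) ×
  (s ≡ 2F → lookup r 5F ≡ same) × (s ≡ 3F → lookup r 4F ≡ same)
labelC-same r with lookup r 2F == same in a
... | true = (λ _ → ==⇒≡ a) , (λ ()) , (λ ()) , (λ ())
... | false with lookup r 3F == same in b
...   | true = (λ ()) , (λ _ → ==⇒≡ b) , (λ ()) , (λ ())
...   | false with lookup r 5F == same in d
...     | true = (λ ()) , (λ ()) , (λ _ → ==⇒≡ d) , (λ ())
...     | false with lookup r 4F == same in c
...       | true = (λ ()) , (λ ()) , (λ ()) , (λ _ → ==⇒≡ c)
...       | false with lookup r 2F == edge
...         | true  = (λ ()) , (λ ()) , (λ ()) , (λ ())
...         | false = (λ ()) , (λ ()) , (λ ()) , (λ ())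

-- Shared by both seeds, which agree on the hole and its labels and differ only in the cliques that
-- receive p and q.
labelledC⇒C : (G : Graph n) (S : Adjacency 6) → S 2F 5F ≡ true → S 3F 4F ≡ true →
  (∀ i → labelC (tabulate (matrix S (suc (suc i)))) ≡ lookup (0F ∷ 1F ∷ 3F ∷ 2F ∷ []) i) →
  (h : InducedIn S G) → let ℓ = λ v → labelC (row G (proj₁ h) v) in
  (∀ u v → u ≢ v → templateC (ℓ u) (ℓ v) (adj G u v) ≡ true) → InC G
labelledC⇒C {n} G S xy₁ xy₂ labels h@(f , inj , adj-f) fits =
  (sideC ∘ ℓ) , clique ,
  (f 2F , f 3F , ne (λ ()) , side-f 0F , side-f 1F) ,
  (f 4F , f 5F , ne (λ ()) , side-f 2F , side-f 3F) ,
  f 2F , f 3F , f 5F , f 4F , side-f 0F , side-f 1F , side-f 3F , side-f 2F , ne (λ ()) , ne (λ ()) ,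
  trans (sym (adj-f 2F 5F (λ ()))) xy₁ , trans (sym (adj-f 3F 4F (λ ()))) xy₂ , only
  where
  R : Realises G (matrix S) f
  R = induced-realises h
  ne : ∀ {i j} → i ≢ j → f i ≢ f j
  ne i≢j e = i≢j (inj e)
  ℓ : Fin n → Fin 6
  ℓ v = labelC (row G f v)
  side-f : ∀ i → sideC (ℓ (f (suc (suc i)))) ≡ sideC (lookup (0F ∷ 1F ∷ 3F ∷ 2F ∷ []) i)
  side-f i = cong sideC (trans (cong labelC (row-inside R _)) (labels i))
  clique : ∀ u v → u ≢ v → sideC (ℓ u) ≡ sideC (ℓ v) → adj G u v ≡ true
  clique u v u≢v e with adj G u v | fits u v u≢v
  ... | true  | _ = refl
  ... | false | p with () ← trans (sym p) (templateC-clique (ℓ u) (ℓ v) e)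
  is : ∀ {v} i → lookup (row G f v) i ≡ same → v ≡ f i
  is {v} i e = rel-same G (trans (sym (lookup∘tabulate (λ i → rel G v (f i)) i)) e)
  only : ∀ u v → sideC (ℓ u) ≡ true → sideC (ℓ v) ≡ false → adj G u v ≡ true →
    (u ≡ f 2F × v ≡ f 5F) ⊎ (u ≡ f 3F × v ≡ f 4F)
  only u v su sv e
    with a₁ , b₁ , _ ← labelC-same (row G f u)
    with _ , _ , d₂ , c₂ ← labelC-same (row G f v)
    with templateC-matching (ℓ u) (ℓ v) su sv (subst (λ b → templateC (ℓ u) (ℓ v) b ≡ true) e (fits u v (adj⇒≢ G e)))
  ... | inj₁ (p , q) = inj₁ (is 2F (a₁ p) , is 5F (d₂ q))
  ... | inj₂ (p , q) = inj₂ (is 3F (b₁ p) , is 4F (c₂ q))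

seedC₁⇒C : (G : Graph n) → FreeOf (withCo (basic ++ seedsA)) G → InducedIn seedC₁ G → InC G
seedC₁⇒C G free h = labelledC⇒C G seedC₁ refl refl (λ { 0F → refl ; 1F → refl ; 2F → refl ; 3F → refl }) h
  (forced G (withCo (basic ++ seedsA)) free seedC₁ templateC labelC seedC₁-forces h)

seedC₂⇒C : (G : Graph n) → FreeOf (withCo (basic ++ seedsA)) G → InducedIn seedC₂ G → InC G
seedC₂⇒C G free h = labelledC⇒C G seedC₂ refl refl (λ { 0F → refl ; 1F → refl ; 2F → refl ; 3F → refl }) h
  (forced G (withCo (basic ++ seedsA)) free seedC₂ templateC labelC seedC₂-forces h)

-- From a labelled edge xy to membership in ℬ.

part : Fin 6 → Part
part 0F = pX
part 1F = pY
part 2F = pX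
part 3F = pY
part 4F = pZ
part 5F = pW

reach-trans : {G : Graph n} {P : Fin n → Set} {u v w : Fin n} → Reach G P u v → Reach G P v w → Reach G P u w
reach-trans Reach.here         r = r
reach-trans (Reach.step e p q) r = Reach.step e p (reach-trans q r)

module _ (G : Graph n) {x y : Fin n} (xy : adj G x y ≡ true) where

  private
    ℓ : Fin n → Fin 6
    ℓ v = labelB (rel G v x) (rel G v y)

  -- P₅ yields a 2K₂; since every edge between X and Y has a neighbour of x and one of y,
  -- that 2K₂ avoids x and y.
  labelled⇒B : (∀ u v → u ≢ v → templateB (ℓ u) (ℓ v) (adj G u v) ≡ true) →
    (∃ λ x′ → ℓ x′ ≡ 2F) → (∃ λ y′ → ℓ y′ ≡ 3F) →
    ¬ InducedInside (co C4) G (λ v → ℓ v ≡ 2F ⊎ ℓ v ≡ 3F) → InB G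
  labelled⇒B fits (x′ , ℓx′) (y′ , ℓy′) no2K₂ =
    L , x , y , cong part ℓx , cong part ℓy , stable ,
    (x′ , cong part ℓx′ , λ { refl → case trans (sym ℓx) ℓx′ of λ () }) ,
    (y′ , cong part ℓy′ , λ { refl → case trans (sym ℓy) ℓy′ of λ () }) ,
    connected , noP₅ , isolated , xY , yX ,
    (λ z p → Zx p , Zy p) , Z-rest
    where
    ⇄_ : ∀ {u v b} → adj G u v ≡ b → adj G v u ≡ b
    ⇄_ = trans (adj-sym G _ _)
    L : Fin n → Part
    L = part ∘ ℓ
    XY : Fin n → Set
    XY v = L v ≡ pX ⊎ L v ≡ pY
    ℓx : ℓ x ≡ 0F
    ℓx rewrite rel-refl G x = refl
    ℓy : ℓ y ≡ 1F
    ℓy rewrite rel-refl G y | rel-edge G (⇄ xy) = refl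
    is-x : ∀ {v} → ℓ v ≡ 0F → v ≡ x
    is-x {v} e with rel G v x in r | rel G v y
    is-x e  | same | _    = rel-same G r
    is-x () | edge | same
    is-x () | edge | edge
    is-x () | edge | none
    is-x () | none | same
    is-x () | none | edge
    is-x () | none | none
    is-y : ∀ {v} → ℓ v ≡ 1F → v ≡ y
    is-y {v} e with rel G v x | rel G v y in r
    is-y e  | edge | same = rel-same G r
    is-y e  | none | same = rel-same G r
    is-y () | same | _
    is-y () | edge | edge
    is-y () | edge | none
    is-y () | none | edge
    is-y () | none | none
    data View (v : Fin n) : Part → Set where
      at-x : v ≡ x → View v pX
      at-y : v ≡ y → View v pY
      in-X : ℓ v ≡ 2F → View v pX
      in-Y : ℓ v ≡ 3F → View v pY
      in-Z : ℓ v ≡ 4F → View v pZ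
      in-W : ℓ v ≡ 5F → View v pW
    view : ∀ {v p} → L v ≡ p → View v p
    view {v} refl with ℓ v in e
    ... | 0F = at-x (is-x e)
    ... | 1F = at-y (is-y e)
    ... | 2F = in-X e
    ... | 3F = in-Y e
    ... | 4F = in-Z e
    ... | 5F = in-W e
    fact : ∀ {u v s t} → ℓ u ≡ s → ℓ v ≡ t → u ≢ v → templateB s t (adj G u v) ≡ true
    fact {u} {v} refl refl = fits u v
    unequal : ∀ {u v s t} → ℓ u ≡ s → ℓ v ≡ t → s ≢ t → u ≢ v
    unequal p q s≢t refl = s≢t (trans (sym p) q)
    xY : ∀ v → L v ≡ pY → adj G x v ≡ true
    xY v p with view p
    ... | at-y refl = xy
    ... | in-Y q    = fact ℓx q (unequal ℓx q λ ())
    yX : ∀ v → L v ≡ pX → adj G y v ≡ true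
    yX v p with view p
    ... | at-x refl = ⇄ xy
    ... | in-X q    = fact ℓy q (unequal ℓy q λ ())
    Zx : ∀ {z} → L z ≡ pZ → adj G z x ≡ true
    Zx p with in-Z q ← view p = fact q ℓx (unequal q ℓx λ ())
    Zy : ∀ {z} → L z ≡ pZ → adj G z y ≡ true
    Zy p with in-Z q ← view p = fact q ℓy (unequal q ℓy λ ())
    Z-rest : ∀ z v → L z ≡ pZ → XY v → v ≢ x → v ≢ y → adj G z v ≡ false
    Z-rest z v p (inj₁ q) v≢x v≢y with view p | view q
    ... | in-Z r | at-x s = ⊥-elim (v≢x s)
    ... | in-Z r | in-X s = off (fact r s (unequal r s λ ()))
    Z-rest z v p (inj₂ q) v≢x v≢y with view p | view q
    ... | in-Z r | at-y s = ⊥-elim (v≢y s)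
    ... | in-Z r | in-Y s = off (fact r s (unequal r s λ ()))
    stable : ∀ u v → L u ≡ L v → adj G u v ≡ false
    stable u v p with u ≟ v
    ... | yes refl = adj-irr G u
    ... | no u≢v with L v | view {u} p | view {v} refl
    ...   | pX | at-x refl | at-x refl = ⊥-elim (u≢v refl)
    ...   | pX | at-x refl | in-X r    = off (fact ℓx r u≢v)
    ...   | pX | in-X q    | at-x refl = off (fact q ℓx u≢v)
    ...   | pX | in-X q    | in-X r    = off (fact q r u≢v)
    ...   | pY | at-y refl | at-y refl = ⊥-elim (u≢v refl)
    ...   | pY | at-y refl | in-Y r    = off (fact ℓy r u≢v)
    ...   | pY | in-Y q    | at-y refl = off (fact q ℓy u≢v)
    ...   | pY | in-Y q    | in-Y r    = off (fact q r u≢v)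
    ...   | pZ | in-Z q    | in-Z r    = off (fact q r u≢v)
    ...   | pW | in-W q    | in-W r    = off (fact q r u≢v)
    isolated : ∀ w u → L w ≡ pW → L u ≢ pW → adj G w u ≡ false
    isolated w u p ≢W with in-W q ← view p = off (fact q refl λ { refl → ≢W p })
    to-x : ∀ {v} → XY v → Reach G XY v x
    to-x (inj₁ p) = Reach.step (⇄ yX _ p) (inj₂ (cong part ℓy)) (Reach.step (⇄ xy) (inj₁ (cong part ℓx)) Reach.here)
    to-x (inj₂ p) = Reach.step (⇄ xY _ p) (inj₁ (cong part ℓx)) Reach.here
    from-x : ∀ {v} → XY v → Reach G XY x v
    from-x (inj₁ p) = Reach.step xy (inj₂ (cong part ℓy)) (Reach.step (yX _ p) (inj₁ p) Reach.here)
    from-x (inj₂ p) = Reach.step (xY _ p) (inj₂ p) Reach.here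
    connected : ConnectedOn G XY
    connected u v p q = reach-trans (to-x p) (from-x q)
    dominated : ∀ {u v w} → w ≡ x ⊎ w ≡ y → XY u → XY v → adj G u v ≡ true → adj G w u ≡ false → adj G w v ≡ false → ⊥
    dominated (inj₁ refl) (inj₂ p) _ _ e _ = not-¬ (xY _ p) e
    dominated (inj₁ refl) _ (inj₂ q) _ _ e = not-¬ (xY _ q) e
    dominated (inj₁ refl) (inj₁ p) (inj₁ q) e _ _ = not-¬ e (stable _ _ (trans p (sym q)))
    dominated (inj₂ refl) (inj₁ p) _ _ e _ = not-¬ (yX _ p) e
    dominated (inj₂ refl) _ (inj₁ q) _ _ e = not-¬ (yX _ q) e
    dominated (inj₂ refl) (inj₂ p) (inj₂ q) e _ _ = not-¬ e (stable _ _ (trans p (sym q)))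
    inner : ∀ {v} → XY v → ¬ (v ≡ x ⊎ v ≡ y) → ℓ v ≡ 2F ⊎ ℓ v ≡ 3F
    inner (inj₁ p) v≢ with view p
    ... | at-x e = ⊥-elim (v≢ (inj₁ e))
    ... | in-X e = inj₁ e
    inner (inj₂ p) v≢ with view p
    ... | at-y e = ⊥-elim (v≢ (inj₂ e))
    ... | in-Y e = inj₂ e
    -- The two end edges 01 and 34 of the P₅ form a 2K₂. They are listed so as to match the edges 02
    -- and 13 of `co C4`.
    ends : Fin 4 → Fin 5
    ends 0F = 0F
    ends 1F = 3F
    ends 2F = 1F
    ends 3F = 4F
    ends-agree : ∀ i j → matrix P5Adj (ends i) (ends j) ≡ matrix (co C4) i j
    ends-agree i j = ==⇒≡ (all-∈ (test i) (all-∈ (λ i → all (test i) (allFin 4)) {allFin 4} refl (∈-allFin i)) (∈-allFin j))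
      where
      test : Fin 4 → Fin 4 → Bool
      test i j = matrix P5Adj (ends i) (ends j) == matrix (co C4) i j
    noP₅ : ¬ InducedInside P5Adj G XY
    noP₅ (f , inj , inside , adj-f) = no2K₂ (occurs-inside {G = G} {f = f ∘ ends} {P = co C4} (λ v → ℓ v ≡ 2F ⊎ ℓ v ≡ 3F)
      (λ i → inner (inside (ends i)) (avoid i)) (realises λ i j → trans (relations R (ends i) (ends j)) (ends-agree i j)) refl)
      where
      R : Realises G (matrix P5Adj) f
      R = induced-realises {P = P5Adj} (f , inj , adj-f)
      ad : ∀ i j → i ≢ j → adj G (f i) (f j) ≡ P5Adj i j
      ad i j i≢j = sym (adj-f i j i≢j)
      avoid : ∀ i → ¬ (f (ends i) ≡ x ⊎ f (ends i) ≡ y)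
      avoid 0F e = dominated e (inside 3F) (inside 4F) (ad 3F 4F (λ ())) (ad 0F 3F (λ ())) (ad 0F 4F (λ ()))
      avoid 2F e = dominated e (inside 3F) (inside 4F) (ad 3F 4F (λ ())) (ad 1F 3F (λ ())) (ad 1F 4F (λ ()))
      avoid 1F e = dominated e (inside 0F) (inside 1F) (ad 0F 1F (λ ())) (ad 3F 0F (λ ())) (ad 3F 1F (λ ()))
      avoid 3F e = dominated e (inside 0F) (inside 1F) (ad 0F 1F (λ ())) (ad 4F 0F (λ ())) (ad 4F 1F (λ ()))

house⇒B : (G : Graph n) → FreeOf (withCo allPatterns) G → InducedIn house G → InB G
house⇒B {n} G free h@(f , _ , adj-f) = labelled⇒B G (sym (adj-f 1F 2F (λ ()))) fits
  (f 3F , f-label 3F) (f 4F , f-label 4F) no2K₂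
  where
  ps = withCo allPatterns
  R : Realises G (matrix house) f
  R = induced-realises h
  ℓ : Fin n → Fin 6
  ℓ v = labelB (rel G v (f 1F)) (rel G v (f 2F))
  fits : ∀ u v → u ≢ v → templateB (ℓ u) (ℓ v) (adj G u v) ≡ true
  fits = forced G (withCo allPatterns) free house templateB (λ r → labelB (lookup r 1F) (lookup r 2F)) house-forces h
  f-label : ∀ i → ℓ (f i) ≡ labelB (matrix house i 1F) (matrix house i 2F)
  f-label i = cong₂ labelB (relations R i 1F) (relations R i 2F)
  no2K₂ : ¬ InducedInside (co C4) G (λ v → ℓ v ≡ 2F ⊎ ℓ v ≡ 3F)
  -- The roof `f 0F` lies in Z and is therefore anticomplete to the 2K₂. The five vertices form 2K₂
  -- + K₁, the complement of the C₄-wheel with four spokes.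
  no2K₂ (g , inj , inner , adj-g) = clash {G = G} ps free (add (f 0F) (none ∷ none ∷ none ∷ none ∷ [])
      (λ { 0F → apart 0F ; 1F → apart 1F ; 2F → apart 2F ; 3F → apart 3F })
      (induced-realises {G = G} {P = co C4} (g , inj , adj-g))) refl
    where
    apart : ∀ i → rel G (f 0F) (g i) ≡ none
    apart i = rel-none G f≢g (off (case inner i of λ
      { (inj₁ e) → subst₂ (λ s t → templateB s t (adj G (f 0F) (g i)) ≡ true) (f-label 0F) e (fits _ _ f≢g)
      ; (inj₂ e) → subst₂ (λ s t → templateB s t (adj G (f 0F) (g i)) ≡ true) (f-label 0F) e (fits _ _ f≢g) }))
      where
      f≢g : f 0F ≢ g i
      f≢g e with inner i
      ... | inj₁ q = case trans (sym (f-label 0F)) (trans (cong ℓ e) q) of λ ()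
      ... | inj₂ q = case trans (sym (f-label 0F)) (trans (cong ℓ e) q) of λ ()

-- Graphs with a C₄ and without seeds and houses

module HouseFree (G : Graph n) (free : FreeOf (withHouse allPatterns) G) (hole : InducedIn C4 G) where

  ρ : Fin n → Fin n → Rel
  ρ = rel G

  flip : ∀ {u v r} → ρ u v ≡ r → ρ v u ≡ r
  flip = trans (rel-sym G _ _)

  ρ-cong : ∀ {u v w r} → ρ u v ≡ same → ρ w v ≡ r → ρ w u ≡ r
  ρ-cong {w = w} e p = trans (cong (ρ w) (rel-same G e)) p

  f : Fin 4 → Fin n
  f = proj₁ hole

  R : Realises G (matrix C4) f
  R = induced-realises {G = G} hole

  no-K₃ : ¬ InducedIn K3 G
  no-K₃ = absent G (withHouse basic) (All.head free ∷ weaken G basic (seedsA ++ seedsC) (All.tail free)) C4 K3 C4-forces-triangle-free hole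

  no-triangle : ∀ {u v w} → ρ u v ≡ edge → ρ v w ≡ edge → ρ u w ≡ edge → ⊥
  no-triangle uv vw uw = no-K₃
    (occurs {G = G} {P = K3} (add _ (edge ∷ edge ∷ []) (λ { 0F → uv ; 1F → uw })
      (add _ (edge ∷ []) (λ { 0F → vw }) (add _ ([]) (λ ()) empty))) refl)

  -- c₀ c₁ c₂ c₃ with the pendants u, v is the complement of seedC₂.
  no-opposite-pendants : ∀ {c₀ c₁ c₂ c₃ u v} →
    ρ c₀ c₁ ≡ edge → ρ c₀ c₂ ≡ none → ρ c₀ c₃ ≡ edge → ρ c₁ c₂ ≡ edge → ρ c₁ c₃ ≡ none → ρ c₂ c₃ ≡ edge →
    ρ u c₀ ≡ edge → ρ u c₁ ≡ none → ρ u c₂ ≡ none → ρ u c₃ ≡ none →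
    ρ v c₀ ≡ none → ρ v c₁ ≡ none → ρ v c₂ ≡ edge → ρ v c₃ ≡ none → ρ u v ≡ none → ⊥
  no-opposite-pendants {c₀} {c₁} {c₂} {c₃} {u} {v} c₀₁ c₀₂ c₀₃ c₁₂ c₁₃ c₂₃ u0 u1 u2 u3 v0 v1 v2 v3 uv =
    clash {G = G} (withHouse allPatterns) free
      (add u (none ∷ edge ∷ none ∷ none ∷ none ∷ []) (λ { 0F → uv ; 1F → u0 ; 2F → u1 ; 3F → u2 ; 4F → u3 })
      (add v (none ∷ none ∷ edge ∷ none ∷ []) (λ { 0F → v0 ; 1F → v1 ; 2F → v2 ; 3F → v3 })
      (add c₀ (edge ∷ none ∷ edge ∷ []) (λ { 0F → c₀₁ ; 1F → c₀₂ ; 2F → c₀₃ })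
      (add c₁ (edge ∷ none ∷ []) (λ { 0F → c₁₂ ; 1F → c₁₃ })
      (add c₂ (edge ∷ []) (λ { 0F → c₂₃ }) (add c₃ ([]) (λ ()) empty)))))) refl

  record TwoEdges (s t s′ t′ : Fin n) : Set where
    constructor two-edges
    field
      st : ρ s t ≡ edge
      s′t′ : ρ s′ t′ ≡ edge
      ss′ : ρ s s′ ≡ none
      st′ : ρ s t′ ≡ none
      ts′ : ρ t s′ ≡ none
      tt′ : ρ t t′ ≡ none

  turn : ∀ {s t s′ t′} → TwoEdges s t s′ t′ → TwoEdges t s s′ t′
  turn (two-edges a b c d e f) = two-edges (flip a) b e f c d

  swap : ∀ {s t s′ t′} → TwoEdges s t s′ t′ → TwoEdges s′ t′ s t
  swap (two-edges a b c d e f) = two-edges b a (flip c) (flip e) (flip d) (flip f)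

  -- The hole s p s′ q carries the pendants t at s and t′ at s′, on opposite vertices; absence of
  -- triangles leaves t and t′ no further neighbours on it.
  same-core : ∀ {s t s′ t′ p q} → ρ p q ≡ none → ρ s p ≡ edge × ρ s q ≡ edge → ρ s′ p ≡ edge × ρ s′ q ≡ edge →
    TwoEdges s t s′ t′ → ⊥
  same-core pq (sp , sq) (s′p , s′q) (two-edges st s′t′ ss′ st′ ts′ tt′) =
    no-opposite-pendants sp ss′ sq (flip s′p) pq s′q (flip st)
      (far st sp s′p (flip ts′)) ts′ (far st sq s′q (flip ts′))
      (flip st′) (far s′t′ s′p sp st′) (flip s′t′) (far s′t′ s′q sq st′) tt′
    where
    far : ∀ {s t s′ p} → ρ s t ≡ edge → ρ s p ≡ edge → ρ s′ p ≡ edge → ρ s′ t ≡ none → ρ t p ≡ none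
    far st sp s′p s′t = dispersed (λ tp → no-triangle st tp sp)
      (λ t≡p → case trans (sym s′t) (ρ-cong t≡p s′p) of λ ())

  Core₀ Core₁ : Fin n → Set
  Core₀ v = ρ v (f 0F) ≡ edge × ρ v (f 2F) ≡ edge
  Core₁ v = ρ v (f 1F) ≡ edge × ρ v (f 3F) ≡ edge

  -- If t sees both `f 0F` and `f 2F`, then t and s′ share their core pair and `same-core` applies.
  -- Otherwise t misses one of them, z, and the hole s, `f 1F`, z, `f 3F` has the opposite pendants
  -- t at s and s′ at z.
  mixed-core : ∀ {s t s′ t′} → Core₁ s → Core₀ s′ → TwoEdges s t s′ t′ → ⊥
  mixed-core {s} {t} {s′} (sb , sd) (s′a , s′c) E@(two-edges st _ ss′ _ ts′ _) = choose (ρ t (f 0F) ≟ᵉ) (ρ t (f 2F) ≟ᵉ)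
    where
    _≟ᵉ : ∀ r → Dec (r ≡ edge)
    same ≟ᵉ = no λ ()
    edge ≟ᵉ = yes refl
    none ≟ᵉ = no λ ()
    go : ∀ {z} → ρ (f 1F) z ≡ edge → ρ z (f 3F) ≡ edge → ρ s′ z ≡ edge → ρ t z ≢ edge → ⊥
    go {z} bz zd s′z t≁z = no-opposite-pendants sb sz sd bz (relations R 1F 3F) zd (flip st)
      (near sb (flip bz)) (dispersed t≁z λ e → case trans (sym sz) (trans (cong (ρ s) (sym (rel-same G e))) st) of λ ())
      (near sd zd)
      (flip ss′) (near′ sb (flip bz)) s′z (near′ sd zd) ts′
      where
      sz : ρ s z ≡ none
      sz = dispersed (λ sz → no-triangle sb bz sz)
        λ e → case trans (sym ss′) (flip (ρ-cong e s′z)) of λ ()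
      near : ∀ {p} → ρ s p ≡ edge → ρ z p ≡ edge → ρ t p ≡ none
      near sp zp = dispersed (λ tp → no-triangle st tp sp) λ e → t≁z (flip (ρ-cong e zp))
      near′ : ∀ {p} → ρ s p ≡ edge → ρ z p ≡ edge → ρ s′ p ≡ none
      near′ sp zp = dispersed (λ s′p → no-triangle s′z zp s′p)
        λ e → case trans (sym ss′) (ρ-cong e sp) of λ ()

    choose : Dec (ρ t (f 0F) ≡ edge) → Dec (ρ t (f 2F) ≡ edge) → ⊥
    choose (yes ta) (yes tc) = same-core (relations R 0F 2F) (ta , tc) (s′a , s′c) (turn E)
    choose (yes _)  (no ≁c)  = go (relations R 1F 2F) (relations R 2F 3F) s′c ≁c
    choose (no ≁a)  _        = go (relations R 1F 0F) (relations R 0F 3F) s′a ≁a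

  core-pair : ∀ {s t s′ t′} → Core₀ s ⊎ Core₁ s → Core₀ s′ ⊎ Core₁ s′ → TwoEdges s t s′ t′ → ⊥
  core-pair (inj₁ c) (inj₁ c′) = same-core (relations R 0F 2F) c c′
  core-pair (inj₂ c) (inj₂ c′) = same-core (relations R 1F 3F) c c′
  core-pair (inj₂ c) (inj₁ c′) = mixed-core c c′
  core-pair (inj₁ c) (inj₂ c′) = mixed-core c′ c ∘ swap

  cover : ∀ {u v} → ρ u v ≡ edge → (Core₀ u ⊎ Core₁ u) ⊎ (Core₀ v ⊎ Core₁ v)
  cover {u} {v} uv = let (u≢v , e) = rel-⟦⟧ G {b = true} uv in
    split (subst (λ b → coverT (core (row G f u)) (core (row G f v)) b ≡ true) e
      (forced G (withHouse allPatterns) free C4 coverT core C4-forces-cover hole u v u≢v))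
    where
    in-core : ∀ w → core (row G f w) ≡ true → Core₀ w ⊎ Core₁ w
    in-core w h with (ρ w (f 0F) == edge) ∧ (ρ w (f 2F) == edge) in e₀
    ... | true  with p , q ← ∧-split e₀ = inj₁ (==⇒≡ p , ==⇒≡ q)
    ... | false with p , q ← ∧-split {ρ w (f 1F) == edge} h = inj₂ (==⇒≡ p , ==⇒≡ q)
    split : core (row G f u) ∨ core (row G f v) ≡ true → (Core₀ u ⊎ Core₁ u) ⊎ (Core₀ v ⊎ Core₁ v)
    split h with core (row G f u) in c
    ... | true  = inj₁ (in-core u c)
    ... | false = inj₂ (in-core v h)

  no-two-edges : ∀ {s t s′ t′} → TwoEdges s t s′ t′ → ⊥
  no-two-edges E@(two-edges st s′t′ _ _ _ _) = choose (cover st) (cover s′t′) E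
    where
    choose : ∀ {s t s′ t′} → (Core₀ s ⊎ Core₁ s) ⊎ (Core₀ t ⊎ Core₁ t) →
      (Core₀ s′ ⊎ Core₁ s′) ⊎ (Core₀ t′ ⊎ Core₁ t′) → TwoEdges s t s′ t′ → ⊥
    choose (inj₁ c) (inj₁ c′) = core-pair c c′
    choose (inj₁ c) (inj₂ c′) = core-pair c c′ ∘ swap ∘ turn ∘ swap
    choose (inj₂ c) (inj₁ c′) = core-pair c c′ ∘ turn
    choose (inj₂ c) (inj₂ c′) = core-pair c c′ ∘ turn ∘ swap ∘ turn ∘ swap

  _⊑_ : Fin n → Fin n → Set
  u ⊑ v = ∀ w → adj G u w ≡ true → adj G v w ≡ true

  _⊑?_ : ∀ u v → Dec (u ⊑ v)
  u ⊑? v = all? λ w → (adj G u w ≟ᵇ true) →-dec (adj G v w ≟ᵇ true)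

  ⋢-witness : ∀ {u v} → ¬ u ⊑ v → ∃ λ w → ρ u w ≡ edge × adj G v w ≡ false
  ⋢-witness {u} {v} h with w , ¬imp ← ¬∀⟶∃¬ _ _ (λ w → (adj G u w ≟ᵇ true) →-dec (adj G v w ≟ᵇ true)) h
    with adj G u w in uw | adj G v w in vw
  ... | true  | false = w , rel-edge G uw , vw
  ... | true  | true  = ⊥-elim (¬imp λ _ → refl)
  ... | false | _     = ⊥-elim (¬imp λ ())

  -- Private neighbours s of u and t of v give the 2K₂ us, vt if s and t are not adjacent, and the
  -- C₅ b u s t v if they are.
  nested : ∀ {b u v} → ρ b u ≡ edge → ρ b v ≡ edge → u ⊑ v ⊎ v ⊑ u
  nested {b} {u} {v} bu bv with u ⊑? v | v ⊑? u
  ... | yes p | _     = inj₁ p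
  ... | no _  | yes q = inj₂ q
  ... | no p  | no q with s , us , v≁s ← ⋢-witness p | t , vt , u≁t ← ⋢-witness q = ⊥-elim (conflict (ρ s t) refl)
    where
    uv : ρ u v ≡ none
    uv = dispersed (λ e → no-triangle bu e bv)
      λ e → not-¬ (proj₂ (rel-⟦⟧ G us)) (trans (cong (λ u → adj G u s) (rel-same G e)) v≁s)
    ut : ρ u t ≡ none
    ut = rel-none G (λ { refl → case trans (sym uv) (flip vt) of λ () }) u≁t
    sv : ρ s v ≡ none
    sv = flip (rel-none G (λ { refl → case trans (sym uv) us of λ () }) v≁s)
    bs : ρ b s ≡ none
    bs = dispersed (λ e → no-triangle bu us e) λ e → case trans (sym sv) (trans (cong (λ w → ρ w v) (sym (rel-same G e))) bv) of λ ()
    bt : ρ b t ≡ none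
    bt = dispersed (λ e → no-triangle bv vt e) λ e → case trans (sym ut) (flip (trans (cong (λ w → ρ w u) (sym (rel-same G e))) bu)) of λ ()
    conflict : ∀ r → ρ s t ≡ r → ⊥
    conflict none e = no-two-edges (two-edges us vt uv ut sv e)
    conflict same e = case trans (sym ut) (trans (cong (ρ u) (sym (rel-same G e))) us) of λ ()
    conflict edge e = clash {G = G} (withHouse allPatterns) free
      (add b (edge ∷ none ∷ none ∷ edge ∷ []) (λ { 0F → bu ; 1F → bs ; 2F → bt ; 3F → bv })
      (add u (edge ∷ none ∷ none ∷ []) (λ { 0F → us ; 1F → ut ; 2F → uv })
      (add s (edge ∷ none ∷ []) (λ { 0F → e ; 1F → sv })
      (add t (edge ∷ []) (λ { 0F → flip vt }) (add v ([]) (λ ()) empty))))) refl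

  maximum : ∀ {b x₀} → ρ b x₀ ≡ edge → ∃ λ x → ρ b x ≡ edge × (∀ {v} → ρ b v ≡ edge → v ⊑ x)
  maximum {b} bx₀ = let (x , bx , _ , max) = go (allFin n) bx₀ in x , bx , λ bv → max (∈-allFin _) bv
    where
    go : ∀ xs {x₀} → ρ b x₀ ≡ edge →
      ∃ λ x → ρ b x ≡ edge × x₀ ⊑ x × (∀ {v} → v ∈ xs → ρ b v ≡ edge → v ⊑ x)
    go [] bx₀ = _ , bx₀ , (λ _ → id) , λ ()
    go (v ∷ xs) {x₀} bx₀ with ρ b v in bv
    ... | edge = case nested bx₀ bv of λ
      { (inj₁ x₀⊑v) → let (x , bx , v⊑x , max) = go xs bv in
          x , bx , (λ w → v⊑x w ∘ x₀⊑v w) , λ { (here refl) _ → v⊑x ; (there i) → max i }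
      ; (inj₂ v⊑x₀) → let (x , bx , x₀⊑x , max) = go xs bx₀ in
          x , bx , x₀⊑x , λ { (here refl) _ → λ w → x₀⊑x w ∘ v⊑x₀ w ; (there i) → max i } }
    ... | same = let (x , bx , x₀⊑x , max) = go xs bx₀ in
      x , bx , x₀⊑x , λ { (here refl) e → case trans (sym bv) e of λ () ; (there i) → max i }
    ... | none = let (x , bx , x₀⊑x , max) = go xs bx₀ in
      x , bx , x₀⊑x , λ { (here refl) e → case trans (sym bv) e of λ () ; (there i) → max i }

  -- Since `f 1F` is a neighbour of x, it is dominated by y. Likewise `f 0F`, a neighbour of `f 1F`,
  -- is dominated by x. These two inclusions supply the second vertices of X and Y from the hole.
  maximal⇒B : ∀ {x y} → ρ (f 1F) x ≡ edge → (∀ {v} → ρ (f 1F) v ≡ edge → v ⊑ x) →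
    ρ x y ≡ edge → (∀ {v} → ρ x v ≡ edge → v ⊑ y) → InB G
  maximal⇒B {x} {y} bx x-max xy y-max = labelled⇒B G (proj₂ (rel-⟦⟧ G xy)) fits other-x other-y no2K₂
    where
    b = f 1F
    ℓ : Fin n → Fin 6
    ℓ v = labelB (ρ v x) (ρ v y)
    ⊑-edge : ∀ {u v w} → u ⊑ v → ρ u w ≡ edge → ρ v w ≡ edge
    ⊑-edge h e = rel-edge G (h _ (proj₂ (rel-⟦⟧ G e)))
    b⊑y : b ⊑ y
    b⊑y = y-max (flip bx)
    W-rel : ∀ r r′ → labelB r r′ ≡ 5F → r ≡ none × r′ ≡ none
    W-rel none none _ = refl , refl
    W-rel same _ ()
    W-rel edge same ()
    W-rel edge edge ()
    W-rel edge none ()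
    W-rel none same ()
    W-rel none edge ()
    isolated : ∀ u v → ℓ u ≡ 5F → adj G u v ≡ false
    isolated u v w with ux , uy ← W-rel _ _ w with adj G u v in e
    ... | false = refl
    -- An edge uv at a vertex u of W forms a 2K₂ with xb: by maximality of x and y, any adjacency
    -- between the two edges would make u a neighbour of x or of y.
    ... | true  = ⊥-elim (no-two-edges (two-edges uv (flip bx) ux
        (dispersed (λ ub → far (⊑-edge b⊑y (flip ub)) uy) λ u≡b → case trans (sym ux) (trans (cong (λ w → ρ w x) (rel-same G u≡b)) bx) of λ ())
        (dispersed (λ vx → far (⊑-edge (y-max (flip vx)) (flip uv)) uy) λ v≡x → case trans (sym ux) (trans (cong (ρ u) (sym (rel-same G v≡x))) uv) of λ ())
        (dispersed (λ vb → far (⊑-edge (x-max (flip vb)) (flip uv)) ux)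
          λ v≡b → far (⊑-edge b⊑y (trans (cong (λ w → ρ w u) (sym (rel-same G v≡b))) (flip uv))) uy)))
      where
      uv : ρ u v ≡ edge
      uv = rel-edge G e
      far : ∀ {w} → ρ w u ≡ edge → ρ u w ≡ none → ⊥
      far p q = case trans (sym (flip p)) q of λ ()
    weak : ∀ u v → u ≢ v → weakB (ℓ u) (ℓ v) (adj G u v) ≡ true
    -- Every entry of the table outside W follows from the absence of triangles over the edge xy.
    weak = compatible-labels {G = G} ((3 , K3) ∷ []) (no-K₃ ∷ [])
      (add x (edge ∷ []) (λ { 0F → xy }) (add y ([]) (λ ()) empty))
      weakB (λ r → labelB (lookup r 0F) (lookup r 1F)) refl
    fits : ∀ u v → u ≢ v → templateB (ℓ u) (ℓ v) (adj G u v) ≡ true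
    fits u v u≢v = strengthen (ℓ u) (isolated u v) (weak u v u≢v)
      where
      strengthen : ∀ s {t b} → (s ≡ 5F → b ≡ false) → weakB s t b ≡ true → templateB s t b ≡ true
      strengthen 0F h p = p
      strengthen 1F h p = p
      strengthen 2F h p = p
      strengthen 3F h p = p
      strengthen 4F h p = p
      strengthen 5F h p = cong not (h refl)
    -- The chosen end w of the edge zw may coincide with p; then its opposite vertex q serves
    -- instead.
    second : ∀ {p q z} → ρ z p ≡ edge → ρ z q ≡ edge → ρ p q ≡ none → ∀ w → ρ z w ≡ edge → ∃ λ v → ρ v w ≡ none × ρ z v ≡ edge
    second {p} {q} zp zq pq w zw with ρ p w in pw
    ... | none = p , pw , zp
    ... | edge = ⊥-elim (no-triangle zp pw zw)
    ... | same = q , flip (trans (cong (λ u → ρ u q) (sym (rel-same G pw))) pq) , zq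
    other-x : ∃ λ v → ℓ v ≡ 2F
    other-x with v , vx , yv ← second (⊑-edge b⊑y (relations R 1F 0F)) (⊑-edge b⊑y (relations R 1F 2F)) (relations R 0F 2F) x (flip xy) =
      v , cong₂ labelB vx (flip yv)
    a⊑x : f 0F ⊑ x
    a⊑x = x-max (relations R 1F 0F)
    other-y : ∃ λ v → ℓ v ≡ 3F
    other-y with v , vy , xv ← second (⊑-edge a⊑x (relations R 0F 1F)) (⊑-edge a⊑x (relations R 0F 3F)) (relations R 1F 3F) y xy =
      v , cong₂ labelB (flip xv) vy
    no2K₂ : ¬ InducedInside (co C4) G (λ v → ℓ v ≡ 2F ⊎ ℓ v ≡ 3F)
    no2K₂ (g , inj , _ , h) = no-two-edges (two-edges (ρg 0F 2F) (ρg 1F 3F) (ρg 0F 1F) (ρg 0F 3F) (ρg 2F 1F) (ρg 2F 3F))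
      where
      ρg : ∀ i j → ρ (g i) (g j) ≡ matrix (co C4) i j
      ρg = relations (induced-realises {G = G} {P = co C4} (g , inj , h))

  bipartite⇒B : InB G
  bipartite⇒B =
    let (x , bx , x-max) = maximum (relations R 1F 0F)
        (y , xy , y-max) = maximum (flip bx)
    in maximal⇒B bx x-max xy y-max

-- Split graphs (Földes and Hammer): a clique built greedily by decreasing degree

splitObstructions : List Pattern
splitObstructions = (4 , C4) ∷ (4 , co C4) ∷ (5 , cycleAdj 5) ∷ []

module Split (G : Graph n) (free : FreeOf splitObstructions G) where

  ρ : Fin n → Fin n → Rel
  ρ = rel G

  flip : ∀ {u v r} → ρ u v ≡ r → ρ v u ≡ r
  flip = trans (rel-sym G _ _)

  neighbours : Fin n → Subset n
  neighbours v = tabulate (adj G v)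

  deg : Fin n → ℕ
  deg v = ∣ neighbours v ∣

  deg-< : ∀ {u v w} → (∀ z → adj G u z ≡ true → adj G v z ≡ true) → adj G v w ≡ true → adj G u w ≡ false → deg u < deg v
  deg-< {u} {v} {w} sub vw uw = p⊂q⇒∣p∣<∣q∣
    ((λ {z} z∈ → to (sub z (from z∈))) , w , to vw , λ w∈ → not-¬ (from w∈) uw)
    where
    to : ∀ {u z} → adj G u z ≡ true → z ∈ₛ neighbours u
    to {u} {z} e = lookup⇒[]= z _ (trans (lookup∘tabulate (adj G u) z) e)
    from : ∀ {u z} → z ∈ₛ neighbours u → adj G u z ≡ true
    from {u} {z} z∈ = trans (sym (lookup∘tabulate (adj G u) z)) ([]=⇒lookup z∈)

  Set-of : Set
  Set-of = Fin n → Bool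

  Clique : Set-of → Set
  Clique K = ∀ u v → u ≢ v → K u ≡ true → K v ≡ true → adj G u v ≡ true

  Blocks : Set-of → Fin n → Fin n → Set
  Blocks K v k = K k ≡ true × k ≢ v × adj G k v ≡ false

  _⊆_ : Set-of → Set-of → Set
  K ⊆ K′ = ∀ k → K k ≡ true → K′ k ≡ true

  Above : ℕ → Set-of → Set
  Above N K = ∀ k → K k ≡ true → N ≤ deg k

  insert : ∀ N v {K} → Clique K → Above N K → N ≤ deg v → (∀ k → ¬ Blocks K v k) →
    ∃ λ K′ → K ⊆ K′ × Clique K′ × Above N K′ × K′ v ≡ true
  insert N v {K} clique above N≤ ¬blocks = K′ , K⊆K′ , clique′ , above′ , trans (cong (K v ∨_) (dec-true (v ≟ v) refl)) (∨-zeroʳ (K v))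
    where
    K′ : Set-of
    K′ u = K u ∨ does (u ≟ v)
    K⊆K′ : K ⊆ K′
    K⊆K′ k e rewrite e = refl
    cases : ∀ {u} → K′ u ≡ true → K u ≡ true ⊎ u ≡ v
    cases {u} e with K u | u ≟ v
    ... | true  | _     = inj₁ refl
    ... | false | yes p = inj₂ p
    above′ : Above N K′
    above′ k e with cases e
    ... | inj₁ p    = above k p
    ... | inj₂ refl = N≤
    joined : ∀ k → k ≢ v → K k ≡ true → adj G k v ≡ true
    joined k k≢v e with adj G k v in kv
    ... | true  = refl
    ... | false = ⊥-elim (¬blocks k (e , k≢v , kv))
    clique′ : Clique K′
    clique′ a b a≢b p q with cases p | cases q
    ... | inj₁ p    | inj₁ q    = clique a b a≢b p q
    ... | inj₁ p    | inj₂ refl = joined a a≢b p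
    ... | inj₂ refl | inj₁ q    = trans (adj-sym G _ _) (joined b (a≢b ∘ sym) q)
    ... | inj₂ refl | inj₂ refl = ⊥-elim (a≢b refl)

  blocker? : ∀ K v → Dec (∃ (Blocks K v))
  blocker? K v = any? λ k → (K k ≟ᵇ true) ×-dec ¬? (k ≟ v) ×-dec (adj G k v ≟ᵇ false)

  -- One pass is enough: the set only grows, so a vertex that is blocked once stays blocked.
  close : ∀ N xs {K} → Clique K → Above N K → ∃ λ K′ → K ⊆ K′ × Clique K′ × Above N K′ ×
    (∀ v → v ∈ xs → N ≤ deg v → K′ v ≡ true ⊎ ∃ (Blocks K′ v))
  close N [] {K} clique above = K , (λ _ → id) , clique , above , λ _ ()
  close N (v ∷ xs) {K} clique above with N ≤? deg v | blocker? K v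
  ... | no N≰ | _ = let (K′ , sub , cl , ab , done) = close N xs clique above in
    K′ , sub , cl , ab , λ { u (here refl) N≤ → ⊥-elim (N≰ N≤) ; u (there i) → done u i }
  ... | yes _ | yes (k , kK , block) = let (K′ , sub , cl , ab , done) = close N xs clique above in
    K′ , sub , cl , ab , λ { u (here refl) _ → inj₂ (k , sub k kK , block) ; u (there i) → done u i }
  ... | yes N≤ | no ∄ = let (K₁ , sub₁ , cl₁ , ab₁ , vK₁) = insert N v clique above N≤ (λ k b → ∄ (k , b))
                            (K′ , sub , cl , ab , done) = close N xs cl₁ ab₁ in
    K′ , (λ k → sub k ∘ sub₁ k) , cl , ab , λ { u (here refl) _ → inj₁ (sub v vK₁) ; u (there i) → done u i }

  -- The threshold `N` descends. A vertex of degree exactly `N` is blocked by a member that has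
  -- entered at this threshold or above, hence of no smaller degree; for larger degrees the earlier
  -- blocker persists. The recursion starts above n, which no degree reaches.
  greedy : ∀ d N → n < d + N → ∃ λ K → Clique K × Above N K ×
    (∀ v → N ≤ deg v → K v ≡ true ⊎ ∃ λ k → Blocks K v k × deg v ≤ deg k)
  greedy zero N n<N = (λ _ → false) , (λ _ _ _ ()) , (λ _ ()) ,
    λ v N≤ → ⊥-elim (ℕₚ.<⇒≱ n<N (ℕₚ.≤-trans N≤ (∣p∣≤n (neighbours v))))
  greedy (suc d) N n< =
    let (K , cl₀ , ab₀ , done₀) = greedy d (suc N) (subst (n <_) (sym (ℕₚ.+-suc d N)) n<)
        (K′ , sub , cl , ab , done) = close N (allFin n) cl₀ (λ k e → ℕₚ.<⇒≤ (ab₀ k e))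
    in K′ , cl , ab , λ v N≤ → settle sub ab (done₀ v) (done v (∈-allFin v) N≤)
    where
    settle : ∀ {K K′ v} → K ⊆ K′ → Above N K′ →
      (N < deg v → K v ≡ true ⊎ ∃ λ k → Blocks K v k × deg v ≤ deg k) →
      K′ v ≡ true ⊎ ∃ (Blocks K′ v) → K′ v ≡ true ⊎ ∃ λ k → Blocks K′ v k × deg v ≤ deg k
    settle {v = v} sub ab old (inj₁ e) = inj₁ e
    settle {v = v} sub ab old (inj₂ (k , b@(kK , _))) with N ℕₚ.<? deg v
    ... | no N≮ = inj₂ (k , b , ℕₚ.≤-trans (ℕₚ.≮⇒≥ N≮) (ab k kK))
    ... | yes N< with old N<
    ...   | inj₁ e = inj₁ (sub v e)
    ...   | inj₂ (l , (lK , bl) , le) = inj₂ (l , (sub l lK , bl) , le)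

  module Greedy (K : Set-of) (clique : Clique K)
    (blocked : ∀ v → K v ≡ false → ∃ λ k → K k ≡ true × ρ v k ≡ none × deg v ≤ deg k) where

    outside : ∀ {u k} → K u ≡ false → K k ≡ true → u ≢ k
    outside p q refl = not-¬ q p

    inside-edge : ∀ {k l} → k ≢ l → K k ≡ true → K l ≡ true → ρ k l ≡ edge
    inside-edge k≢l p q = rel-edge G (clique _ _ k≢l p q)

    no-C4 : ∀ {u v k l} → ρ u v ≡ edge → ρ v k ≡ edge → ρ k l ≡ edge → ρ l u ≡ edge → ρ u k ≡ none → ρ v l ≡ none → ⊥
    no-C4 {u} {v} {k} {l} uv vk kl lu uk vl = clash {G = G} splitObstructions free
      (add u (edge ∷ none ∷ edge ∷ []) (λ { 0F → uv ; 1F → uk ; 2F → flip lu })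
      (add v (edge ∷ none ∷ []) (λ { 0F → vk ; 1F → vl })
      (add k (edge ∷ []) (λ { 0F → kl }) (add l [] (λ ()) empty)))) refl

    no-2K₂ : ∀ {u v k l} → ρ u v ≡ edge → ρ k l ≡ edge → ρ u k ≡ none → ρ u l ≡ none → ρ v k ≡ none → ρ v l ≡ none → ⊥
    no-2K₂ {u} {v} {k} {l} uv kl uk ul vk vl = clash {G = G} splitObstructions free
      (add u (edge ∷ none ∷ none ∷ []) (λ { 0F → uv ; 1F → uk ; 2F → ul })
      (add v (none ∷ none ∷ []) (λ { 0F → vk ; 1F → vl })
      (add k (edge ∷ []) (λ { 0F → kl }) (add l [] (λ ()) empty)))) refl

    -- The degrees are contradictory since N(k) ⊊ N(x): a z in N(k) ∖ N(x) would give a 2K₂, C₄ or C₅.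
    swap-impossible : ∀ {x y k} → ρ x y ≡ edge → K x ≡ false → K y ≡ false → K k ≡ true → ρ x k ≡ none → ρ y k ≡ none →
      (∀ l → K l ≡ true → l ≢ k → ρ x l ≡ edge) → deg x ≤ deg k → ⊥
    swap-impossible {x} {y} {k} xy x∉ y∉ k∈ xk yk complete x≤k =
      ℕₚ.<⇒≱ (deg-< {k} {x} {y} (λ z kz → proj₂ (rel-⟦⟧ G (sub z kz))) (proj₂ (rel-⟦⟧ G xy)) (proj₂ (rel-⟦⟧ G (flip yk)))) x≤k
      where
      sub : ∀ z → adj G k z ≡ true → ρ x z ≡ edge
      sub z kz with ρ x z in xz | K z in zK
      ... | edge | _ = refl
      ... | same | _ = case trans (sym xk) (flip (trans (cong (ρ k) (rel-same G xz)) (rel-edge G kz))) of λ ()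
      ... | none | true  = case trans (sym xz) (complete z zK (adj⇒≢ G kz ∘ sym)) of λ ()
      ... | none | false = ⊥-elim (hop (ρ z y) refl)
        where
        zk : ρ z k ≡ edge
        zk = flip (rel-edge G kz)
        hop : ∀ r → ρ z y ≡ r → ⊥
        hop same e = case trans (sym (flip xz)) (trans (cong (λ w → ρ w x) (rel-same G e)) (flip xy)) of λ ()
        hop none e = no-2K₂ xy zk xz xk (flip e) yk
        -- As z is outside the clique, it has a non-neighbour w in it. If y sees w, then z y w k is
        -- a C₄; otherwise x w k z y is a C₅.
        hop edge zy = let (w , w∈ , zw , _) = blocked z zK in last w w∈ zw (ρ y w) refl
          where
          last : ∀ w → K w ≡ true → ρ z w ≡ none → ∀ r → ρ y w ≡ r → ⊥
          last w w∈ zw r yw = go r yw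
            where
            w≢k : w ≢ k
            w≢k refl = case trans (sym zw) zk of λ ()
            wk : ρ w k ≡ edge
            wk = inside-edge w≢k w∈ k∈
            go : ∀ r → ρ y w ≡ r → ⊥
            go same e = outside y∉ w∈ (rel-same G e)
            go edge e = no-C4 zy e wk (flip zk) zw yk
            go none e = clash {G = G} splitObstructions free
              (add x (edge ∷ none ∷ none ∷ edge ∷ []) (λ { 0F → complete w w∈ w≢k ; 1F → xk ; 2F → xz ; 3F → xy })
              (add w (edge ∷ none ∷ none ∷ []) (λ { 0F → wk ; 1F → flip zw ; 2F → flip e })
              (add k (edge ∷ none ∷ []) (λ { 0F → flip zk ; 1F → flip yk })
              (add z (edge ∷ []) (λ { 0F → zy }) (add y [] (λ ()) empty))))) refl

    other? : ∀ u k → Dec (∃ λ l → K l ≡ true × l ≢ k × adj G u l ≡ false)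
    other? u k = any? λ l → (K l ≟ᵇ true) ×-dec ¬? (l ≟ k) ×-dec (adj G u l ≟ᵇ false)

    complete-but : ∀ {u k} → K u ≡ false → ¬ (∃ λ l → K l ≡ true × l ≢ k × adj G u l ≡ false) →
      ∀ l → K l ≡ true → l ≢ k → ρ u l ≡ edge
    complete-but {u} u∉ ∄ l l∈ l≢k with adj G u l ≟ᵇ true
    ... | yes e = rel-edge G e
    ... | no ¬e = ⊥-elim (∄ (l , l∈ , l≢k , ¬-not ¬e))

    -- The non-neighbours of v are non-neighbours of u, so l is the only one.
    dominated-end : ∀ {u v k l} → ρ u v ≡ edge → K u ≡ false → K v ≡ false →
      K k ≡ true → ρ u k ≡ none → ρ v k ≡ edge → K l ≡ true → ρ v l ≡ none → deg v ≤ deg l → ⊥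
    dominated-end {u} {v} {k} {l} uv u∉ v∉ k∈ uk vk l∈ vl v≤l =
      swap-impossible (flip uv) v∉ u∉ l∈ vl (common l l∈ vl) (complete-but v∉ unique) v≤l
      where
      common : ∀ m → K m ≡ true → ρ v m ≡ none → ρ u m ≡ none
      common m m∈ vm = dispersed
        (λ um → no-C4 uv vk (inside-edge (λ { refl → case trans (sym vm) vk of λ () }) k∈ m∈) (flip um) uk vm)
        (outside u∉ m∈ ∘ rel-same G)
      unique : ¬ (∃ λ m → K m ≡ true × m ≢ l × adj G v m ≡ false)
      unique (m , m∈ , m≢l , e) = no-2K₂ uv (inside-edge m≢l m∈ l∈) (common m m∈ vm) (common l l∈ vl) vm vl
        where
        vm : ρ v m ≡ none
        vm = rel-none G (outside v∉ m∈) e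

    -- Let k and l block the ends u and v of an edge outside the clique. If v sees k, then
    -- `dominated-end` applies. If not, either k is the only non-neighbour of u in the clique and
    -- `swap-impossible` applies, or v sees every other non-neighbour m, since uv and mk are not a
    -- 2K₂, and m takes the place of k.
    stable : ∀ u v → K u ≡ false → K v ≡ false → adj G u v ≡ false
    stable u v u∉ v∉ with adj G u v in e
    ... | false = refl
    ... | true  = let (k , k∈ , uk , u≤k) = blocked u u∉ ; (l , l∈ , vl , v≤l) = blocked v v∉ in
      ⊥-elim (go k∈ uk u≤k l∈ vl v≤l (ρ v k) refl)
      where
      uv : ρ u v ≡ edge
      uv = rel-edge G e
      go : ∀ {k l} → K k ≡ true → ρ u k ≡ none → deg u ≤ deg k → K l ≡ true → ρ v l ≡ none → deg v ≤ deg l →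
        ∀ r → ρ v k ≡ r → ⊥
      go k∈ uk u≤k l∈ vl v≤l same vk = outside v∉ k∈ (rel-same G vk)
      go k∈ uk u≤k l∈ vl v≤l edge vk = dominated-end uv u∉ v∉ k∈ uk vk l∈ vl v≤l
      go {k} k∈ uk u≤k l∈ vl v≤l none vk with other? u k
      ... | no ∄ = swap-impossible uv u∉ v∉ k∈ uk vk (complete-but u∉ ∄) u≤k
      ... | yes (m , m∈ , m≢k , um) = dominated-end uv u∉ v∉ m∈ um′ vm l∈ vl v≤l
        where
        um′ : ρ u m ≡ none
        um′ = rel-none G (outside u∉ m∈) um
        vm : ρ v m ≡ edge
        vm with ρ v m in e
        ... | edge = refl
        ... | same = ⊥-elim (outside v∉ m∈ (rel-same G e))
        ... | none = ⊥-elim (no-2K₂ uv (inside-edge m≢k m∈ k∈) um′ uk e vk)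

  split : IsSplit G
  split = let (K , clique , _ , settled) = greedy (suc n) 0 (s≤s (ℕₚ.m≤m+n n 0)) in
    K , clique , Greedy.stable K clique (λ v v∉ → blocked (settled v z≤n) v∉)
    where
    blocked : ∀ {K v} → (K v ≡ true ⊎ ∃ λ k → Blocks K v k × deg v ≤ deg k) → K v ≡ false →
      ∃ λ k → K k ≡ true × ρ v k ≡ none × deg v ≤ deg k
    blocked (inj₁ p) q = ⊥-elim (not-¬ p q)
    blocked (inj₂ (k , (k∈ , k≢v , e) , le)) _ = k , k∈ , flip (rel-none G k≢v e) , le

-- Complements

invert : Rel → Rel
invert same = same
invert edge = none
invert none = edge

invert-involutive : ∀ r → invert (invert r) ≡ r
invert-involutive same = refl
invert-involutive edge = refl
invert-involutive none = refl

invert-⟦⟧ : ∀ b → invert ⟦ b ⟧ ≡ ⟦ not b ⟧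
invert-⟦⟧ true  = refl
invert-⟦⟧ false = refl

-- A symmetric relation, because complementing twice does not return G definitionally. Every
-- transfer can then be used in both directions.
Complementary : Graph n → Graph n → Set
Complementary G H = ∀ u v → rel H u v ≡ invert (rel G u v)

complementary : (G : Graph n) → Complementary G (complement G)
complementary G u v with u ≟ v
... | yes _ = refl
... | no  _ = sym (invert-⟦⟧ (adj G u v))

complementary-sym : (G H : Graph n) → Complementary G H → Complementary H G
complementary-sym G H c u v = sym (trans (cong invert (c u v)) (invert-involutive _))

mirror : (G H : Graph n) → Complementary G H → (P Q : Adjacency k) → (∀ i j → Q i j ≡ not (P i j)) →
  InducedIn P G → InducedIn Q H
mirror G H c P Q e h = induced {G = H} (proj₁ h) λ i j i≢j →
  trans (c _ _) (trans (cong invert (induced-rel {G = G} h i j i≢j)) (trans (invert-⟦⟧ (P i j)) (cong ⟦_⟧ (sym (e i j)))))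

mirror-noSmall : (G H : Graph n) → Complementary G H → NoSmallWheelAntiwheel G → NoSmallWheelAntiwheel H
mirror-noSmall G H c (noWheel , noAnti) =
  (λ (k , p , q , S , s , h) → noAnti (k , p , q , S , s , mirror H G c′ _ _ (λ _ _ → refl) h)) ,
  (λ (k , p , q , S , s , h) → noWheel (k , p , q , S , s , mirror H G c′ _ _ (λ _ _ → sym (not-involutive _)) h))
  where
  c′ : Complementary H G
  c′ = complementary-sym G H c

mirror-free : (G H : Graph n) → Complementary G H → (xs : List Pattern) → FreeOf (withCo xs) G → FreeOf (withCo xs) H
mirror-free G H c []             _            = []
mirror-free G H c ((k , P) ∷ xs) (p ∷ q ∷ ps) =
  (λ h → q (mirror H G c′ P (co P) (λ _ _ → refl) h)) ∷
  (λ h → p (mirror H G c′ (co P) P (λ _ _ → sym (not-involutive _)) h)) ∷ mirror-free G H c xs ps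
  where
  c′ : Complementary H G
  c′ = complementary-sym G H c

-- Large wheels

noSmall⇒noWheel : (G : Graph n) → NoSmallWheelAntiwheel G → ¬ HasWheel G
noSmall⇒noWheel G (noWheel , noAnti) (k , 4≤k , S , 3≤S , h) with suc k ≤? 7
... | yes k<7 = noWheel (k , 4≤k , k<7 , S , 3≤S , h)
... | no  k≮7 = long k (ℕₚ.≮⇒≥ (k≮7 ∘ ℕₚ.≤-trans ℕₚ.≤-refl)) (rim G h)
  where
  long : ∀ k → 7 ≤ k → InducedIn (cycleAdj k) G → ⊥
  long (suc (suc (suc (suc (suc (suc (suc j))))))) _ h =
    noAnti (4 , ℕₚ.≤-refl , ℕₚ.m≤m+n 5 2 , I ∷ I ∷ I ∷ o ∷ [] , ℕₚ.≤-refl ,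
      occurs {G = G} {M = λ u v → matrix (cycleAdj (7 + j)) (first u) (first v)} {f = proj₁ h ∘ first}
        {P = antiwheelAdj 4 (I ∷ I ∷ I ∷ o ∷ [])} (realises λ u v → relations (induced-realises {G = G} h) (first u) (first v)) refl)
    where
    -- Six consecutive vertices of a cycle of length at least seven induce a P₆, which contains P₃ +
    -- K₂. Their adjacencies compute although `j` is a variable.
    first : Fin 6 → Fin (7 + j)
    first u = u ↑ˡ suc j
  long (suc (suc (suc (suc (suc (suc zero)))))) (s≤s (s≤s (s≤s (s≤s (s≤s (s≤s ()))))))
  long (suc (suc (suc (suc (suc zero))))) (s≤s (s≤s (s≤s (s≤s (s≤s ())))))
  long (suc (suc (suc (suc zero)))) (s≤s (s≤s (s≤s (s≤s ()))))
  long (suc (suc (suc zero))) (s≤s (s≤s (s≤s ())))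
  long (suc (suc zero)) (s≤s (s≤s ()))
  long (suc zero) (s≤s ())

noSmall⇒free : (G : Graph n) → NoSmallWheelAntiwheel G → WheelAntiwheelFree G
noSmall⇒free G ns = noSmall⇒noWheel G ns ,
  λ (k , p , S , s , h) → noSmall⇒noWheel (complement G) (mirror-noSmall G (complement G) (complementary G) ns)
    (k , p , S , s , mirror G (complement G) (complementary G) _ _ (λ _ _ → sym (not-involutive _)) h)

-- Holes of length five and six

-- A vertex off the cycle would have three neighbours on it, which is a wheel, or else complete a
-- pattern of `ps`. The cycle is therefore the whole graph.
cycle⇒hole : (G : Graph n) → NoSmallWheelAntiwheel G → ∀ k → 4 ≤ k → k < 7 → (ps : List Pattern) → FreeOf ps G →
  (∀ r → r ∈ vectors edge-none k → (3 ≤ᵇ ∣ mapᵛ (_== edge) r ∣) ∨ any (occursIn (matrix (cycleAdj k) ▹ r)) ps ≡ true) →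
  InducedIn (cycleAdj k) G → IsHole k G
cycle⇒hole {n} G (noWheel , _) k 4≤k k<7 ps free check h@(f , inj , adj-f) = f , inj , onto , adj-f
  where
  outside : ∀ v → (∀ i → v ≢ f i) → ⊥
  outside v v≢ = go (3 ≤ᵇ ∣ S ∣) refl (check (row G f v) (row-outside {G = G} v≢))
    where
    S : Subset k
    S = mapᵛ (_== edge) (row G f v)
    wheel : ∀ i j → i ≢ j → rel G ((v ◃ f) i) ((v ◃ f) j) ≡ ⟦ wheelAdj k S i j ⟧
    spoke : ∀ i → rel G v (f i) ≡ ⟦ lookup S i ⟧
    spoke i = trans (rel-≢ G (v≢ i)) (cong ⟦_⟧ (sym (trans (lookup-map i (_== edge) (row G f v))
      (trans (cong (_== edge) (trans (lookup∘tabulate (λ i → rel G v (f i)) i) (rel-≢ G (v≢ i)))) (⟦⟧==edge (adj G v (f i)))))))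
      where
      ⟦⟧==edge : ∀ b → (⟦ b ⟧ == edge) ≡ b
      ⟦⟧==edge true  = refl
      ⟦⟧==edge false = refl
    wheel zero    zero    i≢j = ⊥-elim (i≢j refl)
    wheel zero    (suc j) _   = spoke j
    wheel (suc i) zero    _   = trans (rel-sym G _ _) (spoke i)
    wheel (suc i) (suc j) i≢j = induced-rel {G = G} h i j (i≢j ∘ cong suc)
    go : ∀ b → (3 ≤ᵇ ∣ S ∣) ≡ b → b ∨ any (occursIn (matrix (cycleAdj k) ▹ row G f v)) ps ≡ true → ⊥
    go true  e _ = noWheel (k , 4≤k , k<7 , S , ℕₚ.≤ᵇ⇒≤ 3 ∣ S ∣ (Equivalence.from T-≡ e) , induced {G = G} (v ◃ f) wheel)
    go false _ e = clash {G = G} ps free (add-row (induced-realises {G = G} h) v) e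
  onto : ∀ v → ∃ λ i → f i ≡ v
  onto v with any? (λ i → f i ≟ v)
  ... | yes p = p
  ... | no ∄  = ⊥-elim (outside v λ i e → ∄ (i , sym e))

-- As C₅ is its own complement, a vertex with at most two neighbours on it is the hub of an
-- antiwheel. The four sets represent, up to symmetry of the cycle, all sets of at least three
-- vertices.
cycle⇒hole₅ : (G : Graph n) → NoSmallWheelAntiwheel G → InducedIn (cycleAdj 5) G → IsHole 5 G
cycle⇒hole₅ G ns = cycle⇒hole G ns 5 (ℕₚ.m≤m+n 4 1) (ℕₚ.m≤m+n 6 1) ps
  ( none-of (I ∷ I ∷ I ∷ I ∷ I ∷ []) (ℕₚ.m≤m+n 3 2) ∷ none-of (I ∷ I ∷ I ∷ I ∷ o ∷ []) (ℕₚ.m≤m+n 3 1)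
  ∷ none-of (I ∷ I ∷ I ∷ o ∷ o ∷ []) ℕₚ.≤-refl ∷ none-of (I ∷ I ∷ o ∷ I ∷ o ∷ []) ℕₚ.≤-refl ∷ [])
  (λ r → all-∈ test {vectors edge-none 5} refl)
  where
  ps : List Pattern
  ps = map (λ S → 6 , antiwheelAdj 5 S) ((I ∷ I ∷ I ∷ I ∷ I ∷ []) ∷ (I ∷ I ∷ I ∷ I ∷ o ∷ []) ∷ (I ∷ I ∷ I ∷ o ∷ o ∷ []) ∷ (I ∷ I ∷ o ∷ I ∷ o ∷ []) ∷ [])
  test : Vec Rel 5 → Bool
  test r = (3 ≤ᵇ ∣ mapᵛ (_== edge) r ∣) ∨ any (occursIn (matrix (cycleAdj 5) ▹ r)) ps
  none-of : ∀ S → 3 ≤ ∣ S ∣ → ¬ InducedIn (antiwheelAdj 5 S) G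
  none-of S p h = proj₂ ns (5 , ℕₚ.m≤m+n 4 1 , ℕₚ.m≤m+n 6 1 , S , p , h)

module _ (G : Graph n) (ns : NoSmallWheelAntiwheel G) where

  noWheel₄ : ∀ S → 3 ≤ ∣ S ∣ → ¬ InducedIn (wheelAdj 4 S) G
  noWheel₄ S p h = proj₁ ns (4 , ℕₚ.≤-refl , ℕₚ.m≤m+n 5 2 , S , p , h)

  noAntiwheel₄ : ∀ S → 3 ≤ ∣ S ∣ → ¬ InducedIn (antiwheelAdj 4 S) G
  noAntiwheel₄ S p h = proj₂ ns (4 , ℕₚ.≤-refl , ℕₚ.m≤m+n 5 2 , S , p , h)

  cycle⇒hole₆ : InducedIn (cycleAdj 6) G → IsHole 6 G
  cycle⇒hole₆ = cycle⇒hole G ns 6 (ℕₚ.m≤m+n 4 2) ℕₚ.≤-refl ps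
    (noAntiwheel₄ _ ℕₚ.≤-refl ∷ noAntiwheel₄ _ (ℕₚ.m≤m+n 3 1) ∷ []) (λ r → all-∈ test {vectors edge-none 6} refl)
    where
    ps : List Pattern
    ps = map (λ S → 5 , antiwheelAdj 4 S) ((I ∷ I ∷ I ∷ o ∷ []) ∷ (I ∷ I ∷ I ∷ I ∷ []) ∷ [])
    test : Vec Rel 6 → Bool
    test r = (3 ≤ᵇ ∣ mapᵛ (_== edge) r ∣) ∨ any (occursIn (matrix (cycleAdj 6) ▹ r)) ps

  noHoles⇒basicFree : ¬ InducedIn (cycleAdj 5) G → ¬ InducedIn (cycleAdj 6) G → ¬ InducedIn (co (cycleAdj 6)) G →
    FreeOf (withCo basic) G
  noHoles⇒basicFree no5 no6 noCo6 =
    noWheel₄ _ ℕₚ.≤-refl ∷ noAntiwheel₄ _ ℕₚ.≤-refl ∷ noWheel₄ _ (ℕₚ.m≤m+n 3 1) ∷ noAntiwheel₄ _ (ℕₚ.m≤m+n 3 1) ∷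
    no5 ∷ (no5 ∘ subpattern {G = G} (co (cycleAdj 5)) refl) ∷ no6 ∷ noCo6 ∷ []

-- The structure theorem

C4⇒B : (G : Graph n) → FreeOf (withCo allPatterns) G → InducedIn C4 G → InB G
C4⇒B G free hole = split (induced? {G = G} house)
  where
  split : Dec (InducedIn house G) → InB G
  split (yes h) = house⇒B G free h
  split (no ¬h) = HouseFree.bipartite⇒B G (¬h ∷ free) hole

module _ (G : Graph n) where

  private
    G̅ : Graph n
    G̅ = complement G

  -- A copy of `co P` in G is a copy of `P` in the complement, so each seed needs its implication
  -- for both graphs.
  findSeeds : (Good : Graph n → Set) (xs : List Pattern) →
    All (λ (k , P) → (InducedIn P G → Good G) × (InducedIn P G̅ → Good G̅)) xs →
    FreeOf (withCo xs) G ⊎ Good G ⊎ Good G̅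
  findSeeds Good []             _              = inj₁ []
  findSeeds Good ((k , P) ∷ xs) ((g , g̅) ∷ gs) = choose (induced? {G = G} P) (induced? {G = G} (co P)) (findSeeds Good xs gs)
    where
    choose : Dec (InducedIn P G) → Dec (InducedIn (co P) G) → FreeOf (withCo xs) G ⊎ Good G ⊎ Good G̅ →
      FreeOf (withCo ((k , P) ∷ xs)) G ⊎ Good G ⊎ Good G̅
    choose (yes h) _       _           = inj₂ (inj₁ (g h))
    choose (no _)  (yes h) _           = inj₂ (inj₂ (g̅ (mirror G G̅ (complementary G) (co P) P (λ _ _ → sym (not-involutive _)) h)))
    choose (no p)  (no q)  (inj₁ free) = inj₁ (p ∷ q ∷ free)
    choose (no _)  (no _)  (inj₂ good) = inj₂ good

  structured : NoSmallWheelAntiwheel G → Structured G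
  structured ns = holes (induced? {G = G} (cycleAdj 5)) (induced? {G = G} (cycleAdj 6)) (induced? {G = G} (co (cycleAdj 6)))
    where
    ns̅ : NoSmallWheelAntiwheel G̅
    ns̅ = mirror-noSmall G G̅ (complementary G) ns
    rest : FreeOf (withCo allPatterns) G → ¬ InducedIn (cycleAdj 5) G → Dec (InducedIn C4 G) → Dec (InducedIn (co C4) G) → Structured G
    rest free no5 (yes h) _        = inj₁ (inj₂ (inj₂ (inj₂ (inj₂ (inj₁ (C4⇒B G free h))))))
    rest free no5 (no _)  (yes h)  = inj₂ (inj₂ (inj₂ (inj₂ (inj₂ (inj₁ (C4⇒B G̅ (mirror-free G G̅ (complementary G) allPatterns free)
      (mirror G G̅ (complementary G) (co C4) C4 (λ _ _ → sym (not-involutive _)) h)))))))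
    rest free no5 (no p)  (no q)   = inj₁ (inj₂ (inj₂ (inj₁ (Split.split G (p ∷ q ∷ no5 ∷ [])))))
    seedC : FreeOf (withCo (basic ++ seedsA)) G → ¬ InducedIn (cycleAdj 5) G → FreeOf (withCo seedsC) G ⊎ InC G ⊎ InC G̅ → Structured G
    seedC free no5 (inj₁ freeC)    = rest (free-++ G basic (seedsA ++ seedsC) (weaken G basic seedsA free)
      (free-++ G seedsA seedsC (weakenʳ G basic seedsA free) freeC)) no5 (induced? {G = G} C4) (induced? {G = G} (co C4))
    seedC free no5 (inj₂ (inj₁ c)) = inj₁ (inj₂ (inj₂ (inj₂ (inj₂ (inj₂ c)))))
    seedC free no5 (inj₂ (inj₂ c)) = inj₂ (inj₂ (inj₂ (inj₂ (inj₂ (inj₂ c)))))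
    seedA′ : FreeOf (withCo basic) G → ¬ InducedIn (cycleAdj 5) G → FreeOf (withCo seedsA) G ⊎ InA G ⊎ InA G̅ → Structured G
    seedA′ free no5 (inj₁ freeA)    = seedC freeBA no5 (findSeeds InC seedsC
      ((seedC₁⇒C G freeBA , seedC₁⇒C G̅ freeBA̅) ∷ (seedC₂⇒C G freeBA , seedC₂⇒C G̅ freeBA̅) ∷ []))
      where
      freeBA : FreeOf (withCo (basic ++ seedsA)) G
      freeBA = free-++ G basic seedsA free freeA
      freeBA̅ : FreeOf (withCo (basic ++ seedsA)) G̅
      freeBA̅ = mirror-free G G̅ (complementary G) (basic ++ seedsA) freeBA
    seedA′ free no5 (inj₂ (inj₁ a)) = inj₁ (inj₂ (inj₂ (inj₂ (inj₁ a))))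
    seedA′ free no5 (inj₂ (inj₂ a)) = inj₂ (inj₂ (inj₂ (inj₂ (inj₁ a))))
    holes : Dec (InducedIn (cycleAdj 5) G) → Dec (InducedIn (cycleAdj 6) G) → Dec (InducedIn (co (cycleAdj 6)) G) → Structured G
    holes (yes h) _ _ = inj₁ (inj₁ (cycle⇒hole₅ G ns h))
    holes (no _) (yes h) _ = inj₁ (inj₂ (inj₁ (cycle⇒hole₆ G ns h)))
    holes (no _) (no _) (yes h) = inj₂ (inj₂ (inj₁ (cycle⇒hole₆ G̅ ns̅ (mirror G G̅ (complementary G) (co (cycleAdj 6)) (cycleAdj 6) (λ _ _ → sym (not-involutive _)) h))))
    holes (no no5) (no no6) (no noCo6) = seedA′ free no5 (findSeeds InA seedsA
      ((seedA⇒A G free false , seedA⇒A G̅ free̅ false) ∷ (seedA⇒A G free true , seedA⇒A G̅ free̅ true) ∷ []))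
      where
      free : FreeOf (withCo basic) G
      free = noHoles⇒basicFree G ns no5 no6 noCo6
      free̅ : FreeOf (withCo basic) G̅
      free̅ = mirror-free G G̅ (complementary G) basic free

basic⇒noSmall : (G : Graph n) → Basic G → NoSmallWheelAntiwheel G
basic⇒noSmall G (inj₁ h)                             = hole₅⇒noSmall G h
basic⇒noSmall G (inj₂ (inj₁ h))                      = hole₆⇒noSmall G h
basic⇒noSmall G (inj₂ (inj₂ (inj₁ s)))               = split⇒noSmall G s
basic⇒noSmall G (inj₂ (inj₂ (inj₂ (inj₁ a))))        = A⇒noSmall G a
basic⇒noSmall G (inj₂ (inj₂ (inj₂ (inj₂ (inj₁ b))))) = B⇒noSmall G b
basic⇒noSmall G (inj₂ (inj₂ (inj₂ (inj₂ (inj₂ c))))) = C⇒noSmall G c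

structured⇒noSmall : (G : Graph n) → Structured G → NoSmallWheelAntiwheel G
structured⇒noSmall G (inj₁ b) = basic⇒noSmall G b
structured⇒noSmall G (inj₂ b) = mirror-noSmall (complement G) G
  (complementary-sym G (complement G) (complementary G)) (basic⇒noSmall (complement G) b)

theorem3 : (n : ℕ) (G : Graph n) →
    (WheelAntiwheelFree G ⇔ NoSmallWheelAntiwheel G) ×
    (NoSmallWheelAntiwheel G ⇔ Structured G)
theorem3 n G =
  mk⇔ (λ (noWheel , noAnti) → (λ (k , p , _ , S , s , h) → noWheel (k , p , S , s , h)) ,
                               (λ (k , p , _ , S , s , h) → noAnti (k , p , S , s , h)))
      (noSmall⇒free G) ,
  mk⇔ (structured G) (structured⇒noSmall G)
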